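{- For each integer $t\ge 1$ let $S_{\mathrm c}(t)$ be the number of $3\times 3$ semimagic squares all of whose entries are strictly between $0$ and $t$. Then $$\sum_{t>0} S_{\mathrm c}(t)\,x^t=\frac{72x^{10}\left[18x^9+46x^8+69x^7+74x^6+65x^5+46x^4+26x^3+11x^2+4x+1\right]}{(1-x^2)^2(1-x^3)^2(1-x^4)(1-x^5)}.$$ Moreover, for every integer $t\ge1$, $$S_{\mathrm c}(t)=\begin{cases}\frac{3}{10}t^5-\frac{75}{8}t^4+\frac{331}{3}t^3-\frac{5989}{10}t^2+c_1(t)\,t-c_0(t), & t \text{ even},\\[3pt] \frac{3}{10}t^5-\frac{75}{8}t^4+\frac{331}{3}t^3-\frac{11933}{20}t^2+c_1(t)\,t-c_0(t), & t\text{ odd},\end{cases}$$ where $c_1(t)=1464$ if $t\equiv 0,2$; $1456$ if $t\equiv 4$; $\frac{2831}{2}$ if $t\equiv 1$; $\frac{2847}{2}$ if $t\equiv 3,5 \pmod 6$; and $c_0(t)$ depends only on $t$ modulo $60$ and is given as follows, where in the line for $r$ the five numbers are the values of $c_0$ at $t\equiv r,\ r+12,\ r+24,\ r+36,\ r+48 \pmod{60}$, in this order: $r=0$: $1296,\ 1296,\ \frac{6624}{5},\ \frac{6192}{5},\ \frac{6624}{5}$; $r=1$: $\frac{110413}{120},\ \frac{120781}{120},\ \frac{23465}{24},\ \frac{23465}{24},\ \frac{120781}{120}$; $r=2$: $\frac{3824}{3},\ \frac{19552}{15},\ \frac{18256}{15},\ \frac{19552}{15},\ \frac{3824}{3}$;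 $r=3$: $\frac{47727}{40},\ \frac{9315}{8},\ \frac{9315}{8},\ \frac{47727}{40},\ \frac{44271}{40}$; $r=4$: $\frac{18152}{15},\ \frac{16856}{15},\ \frac{18152}{15},\ \frac{3544}{3},\ \frac{3544}{3}$; $r=5$: $\frac{25705}{24},\ \frac{25705}{24},\ \frac{131981}{120},\ \frac{121613}{120},\ \frac{131981}{120}$; $r=6$: $\frac{6192}{5},\ \frac{6624}{5},\ 1296,\ 1296,\ \frac{6624}{5}$; $r=7$: $\frac{25193}{24},\ \frac{129421}{120},\ \frac{119053}{120},\ \frac{129421}{120},\ \frac{25193}{24}$; $r=8$: $\frac{19552}{15},\ \frac{3824}{3},\ \frac{3824}{3},\ \frac{19552}{15},\ \frac{18256}{15}$; $r=9$: $\frac{44847}{40},\ \frac{41391}{40},\ \frac{44847}{40},\ \frac{8739}{8},\ \frac{8739}{8}$; $r=10$: $\frac{3544}{3},\ \frac{3544}{3},\ \frac{18152}{15},\ \frac{16856}{15},\ \frac{18152}{15}$; $r=11$: $\frac{130253}{120},\ \frac{140621}{120},\ \frac{27433}{24},\ \frac{27433}{24},\ \frac{140621}{120}$. The quasipolynomial $S_{\mathrm c}$ has period exactly $60$, and its principal constituent is $\frac{3}{10}t^5-\frac{75}{8}t^4+\frac{331}{3}t^3-\frac{5989}{10}t^2+1464t-1296$.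
   Context: A $3\times3$ semimagic square (in the strong sense) is a $3\times 3$ matrix of pairwise distinct positive integers in which all three row sums and all three column sums are equal. Squares are counted as matrices (not up to symmetry). A function $N$ of $t\in\mathbb Z_{>0}$ is a quasipolynomial if there are a positive integer $p$ and polynomials $N_0,\dots,N_{p-1}$ (the constituents) with $N(t)=N_{t \bmod p}(t)$; the minimal such $p$ is the period, and $N_0$ is the principal constituent. -}

module Defs where

open import Data.Fin.Base using (Fin; toℕ; remQuot)
open import Data.Integer.Base as ℤ using (ℤ; +_; 0ℤ)
import Data.Integer.Properties as ℤ
open import Data.List.Base as List using (List; []; _∷_; upTo; cartesianProductWith; filter; length)
open import Data.List.Membership.Propositional using (_∈_)
open import Data.List.Membership.Propositional.Properties
  using (∈-filter⁺; ∈-filter⁻; ∈-upTo⁺; ∈-cartesianProductWith⁺)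
import Data.List.Relation.Unary.Any as Any
import Data.List.Relation.Unary.AllPairs as ListAllPairs
import Data.List.Relation.Unary.All as ListAll
import Data.List.Relation.Unary.Unique.Propositional as List
import Data.List.Relation.Unary.Unique.Propositional.Properties as ListUnique
open import Data.Nat.Base using (ℕ; zero; suc; _+_; _∸_; _≤_; _<_; _≥_; NonZero)
open import Data.Nat.DivMod using (_mod_)
import Data.Nat.Properties as ℕ
open import Data.Product.Base using (∃-syntax; _×_; _,_; proj₁; proj₂)
open import Data.Rational.Base as ℚ using (ℚ; 0ℚ; _/_)
open import Data.Vec.Base as Vec using (Vec; []; _∷_; concat; lookup; sum; transpose)
open import Data.Vec.Properties using (∷-injective)
open import Data.Vec.Relation.Unary.All as All using (All; []; _∷_)
open import Data.Vec.Relation.Unary.All.Properties using (concat⁻)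
open import Data.Vec.Relation.Unary.AllPairs using (allPairs?)
open import Data.Vec.Relation.Unary.Unique.Propositional using (Unique)
open import Function.Bundles using (_⇔_; mk⇔)
open import Relation.Binary.PropositionalEquality using (_≡_; refl)
open import Relation.Nullary.Decidable using (Dec; ¬?; _×-dec_; map′)
open import Algebra.Definitions.RawSemiring ℚ.+-*-rawSemiring public using (_^_)
open import Algebra.Properties.CommutativeMonoid.Sum ℤ.+-0-commutativeMonoid using (sum-syntax; sum⁺-syntax)

Matrix : Set
Matrix = Vec (Vec ℕ 3) 3

EqualLineSums : Matrix → Set
EqualLineSums M = ∃[ s ] All (λ r → sum r ≡ s) M × All (λ c → sum c ≡ s) (transpose M)

record IsSemimagic (M : Matrix) : Set where
  constructor mkSemimagic
  field
    positive : All (0 <_) (concat M)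
    distinct : Unique (concat M)
    lineSums : EqualLineSums M

IsCounted : ℕ → Matrix → Set
IsCounted t M = IsSemimagic M × All (λ a → 0 < a × a < t) (concat M)

equalLineSums? : ∀ M → Dec (EqualLineSums M)
equalLineSums? M@(r ∷ _) =
  map′ (sum r ,_) (λ { (s , refl ∷ rs , cs) → refl ∷ rs , cs })
    (All.all? (λ v → sum v ℕ.≟ sum r) M ×-dec All.all? (λ v → sum v ℕ.≟ sum r) (transpose M))

isSemimagic? : ∀ M → Dec (IsSemimagic M)
isSemimagic? M =
  map′ (λ (p , d , l) → mkSemimagic p d l) (λ (mkSemimagic p d l) → p , d , l)
    (All.all? (0 ℕ.<?_) (concat M)
      ×-dec allPairs? (λ a b → ¬? (a ℕ.≟ b)) (concat M)
      ×-dec equalLineSums? M)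

isCounted? : ∀ t M → Dec (IsCounted t M)
isCounted? t M = isSemimagic? M ×-dec All.all? (λ a → 0 ℕ.<? a ×-dec a ℕ.<? t) (concat M)

vectorsOver : {A : Set} → List A → ∀ n → List (Vec A n)
vectorsOver xs zero    = [] ∷ []
vectorsOver xs (suc n) = cartesianProductWith _∷_ xs (vectorsOver xs n)

semimagicSquares : ℕ → List Matrix
semimagicSquares t = filter (isCounted? t) (vectorsOver (vectorsOver (upTo t) 3) 3)

Sc : ℕ → ℕ
Sc t = length (semimagicSquares t)

-- semimagicSquares-members and semimagicSquares-unique certify that Sc t is the cardinality of
-- { M ∣ IsCounted t M }: the list has exactly these members, each once.

vectorsOver-complete : ∀ {A : Set} {xs : List A} {n} {v : Vec A n} →
                       All (_∈ xs) v → v ∈ vectorsOver xs n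
vectorsOver-complete []       = Any.here refl
vectorsOver-complete (p ∷ ps) = ∈-cartesianProductWith⁺ _∷_ p (vectorsOver-complete ps)

vectorsOver-unique : ∀ {A : Set} {xs : List A} n → List.Unique xs → List.Unique (vectorsOver xs n)
vectorsOver-unique zero    u = ListAll.[] ListAllPairs.∷ ListAllPairs.[]
vectorsOver-unique (suc n) u = ListUnique.cartesianProductWith⁺ _∷_ ∷-injective u (vectorsOver-unique n u)

semimagicSquares-members : ∀ t M → M ∈ semimagicSquares t ⇔ IsCounted t M
semimagicSquares-members t M = mk⇔
  (λ M∈ → proj₂ (∈-filter⁻ (isCounted? t) {xs = candidates} M∈))
  (λ c → ∈-filter⁺ (isCounted? t) (candidate (proj₂ c)) c)
  where
  candidates = vectorsOver (vectorsOver (upTo t) 3) 3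

  candidate : All (λ a → 0 < a × a < t) (concat M) → M ∈ candidates
  candidate bounds = vectorsOver-complete
    (All.map (λ row → vectorsOver-complete (All.map (λ (_ , a<t) → ∈-upTo⁺ a<t) row))
             (concat⁻ M bounds))

semimagicSquares-unique : ∀ t → List.Unique (semimagicSquares t)
semimagicSquares-unique t =
  ListUnique.filter⁺ (isCounted? t) (vectorsOver-unique 3 (vectorsOver-unique 3 (ListUnique.upTo⁺ t)))

-- Formal power series over ℤ, given by their coefficients.

Series : Set
Series = ℕ → ℤ

infix  4 _≈ₛ_
infixl 6 _⊕_ _⊖_
infixl 7 _⊛_
infixr 8 _^ₛ_
infix  7.5 _·x^_

_≈ₛ_ : Series → Series → Set
f ≈ₛ g = ∀ n → f n ≡ g n

_⊕_ _⊖_ _⊛_ : Series → Series → Series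
(f ⊕ g) n = f n ℤ.+ g n
(f ⊖ g) n = f n ℤ.- g n
(f ⊛ g) n = ∑[ i ≤ n ] (f (toℕ i) ℤ.* g (n ∸ toℕ i))

_·x^_ : ℤ → ℕ → Series
(c ·x^ zero)  zero    = c
(c ·x^ zero)  (suc n) = 0ℤ
(c ·x^ suc k) zero    = 0ℤ
(c ·x^ suc k) (suc n) = (c ·x^ k) n

_^ₛ_ : Series → ℕ → Series
f ^ₛ zero  = + 1 ·x^ 0
f ^ₛ suc k = f ⊛ (f ^ₛ k)

-- f = p / q in ℤ[[x]]: q is invertible and f = p q⁻¹.
_≈_÷_ : Series → Series → Series → Set
f ≈ p ÷ q = ∃[ q⁻¹ ] (q ⊛ q⁻¹ ≈ₛ + 1 ·x^ 0) × (f ≈ₛ p ⊛ q⁻¹)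

-- ∑_{t>0} N(t) x^t
generatingSeries : (ℕ → ℕ) → Series
generatingSeries N zero      = 0ℤ
generatingSeries N t@(suc _) = + N t

ScNumerator ScDenominator : Series
ScNumerator = + 72 ·x^ 10 ⊛
  (+ 18 ·x^ 9 ⊕ + 46 ·x^ 8 ⊕ + 69 ·x^ 7 ⊕ + 74 ·x^ 6 ⊕ + 65 ·x^ 5
    ⊕ + 46 ·x^ 4 ⊕ + 26 ·x^ 3 ⊕ + 11 ·x^ 2 ⊕ + 4 ·x^ 1 ⊕ + 1 ·x^ 0)
ScDenominator = (1-x^ 2) ^ₛ 2 ⊛ (1-x^ 3) ^ₛ 2 ⊛ (1-x^ 4) ⊛ (1-x^ 5)
  where
  1-x^_ : ℕ → Series
  1-x^ k = + 1 ·x^ 0 ⊖ + 1 ·x^ k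

ℕ→ℚ : ℕ → ℚ
ℕ→ℚ n = + n / 1

-- Polynomials over ℚ as coefficient lists, constant term first; trailing
-- zeros are allowed, so polynomials are compared by _≈ₚ_.

Poly : Set
Poly = List ℚ

eval : Poly → ℚ → ℚ
eval []      x = 0ℚ
eval (a ∷ P) x = a ℚ.+ x ℚ.* eval P x

coeff : Poly → ℕ → ℚ
coeff []      _       = 0ℚ
coeff (a ∷ P) zero    = a
coeff (a ∷ P) (suc k) = coeff P k

infix 4 _≈ₚ_

_≈ₚ_ : Poly → Poly → Set
P ≈ₚ Q = ∀ k → coeff P k ≡ coeff Q k

-- Functions of a positive integer are represented as functions on ℕ whose
-- value at 0 is ignored.

record Constituents (N : ℕ → ℚ) (p : ℕ) .{{_ : NonZero p}} : Set where
  field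
    constituent : Fin p → Poly
    agrees      : ∀ t → t ≥ 1 → N t ≡ eval (constituent (t mod p)) (ℕ→ℚ t)

HasPeriod : (N : ℕ → ℚ) (p : ℕ) .{{_ : NonZero p}} → Set
HasPeriod N p = Constituents N p × (∀ q .{{_ : NonZero q}} → Constituents N q → p ≤ q)

record HasPrincipalConstituent (N : ℕ → ℚ) (P : Poly) : Set where
  field
    period      : ℕ
    .{{nonZero}} : NonZero period
    hasPeriod   : HasPeriod N period
    principal   : (C : Constituents N period) → Constituents.constituent C (0 mod period) ≈ₚ P

c₁ : ℕ → ℚ
c₁ t = lookup (+ 1464 / 1 ∷ + 2831 / 2 ∷ + 1464 / 1 ∷ + 2847 / 2 ∷ + 1456 / 1 ∷ + 2847 / 2 ∷ []) (t mod 6)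

-- Row r lists the values of c₀ at t ≡ r, r+12, r+24, r+36, r+48 (mod 60).
c₀-table : Vec (Vec ℚ 5) 12
c₀-table =
  (+ 1296 / 1 ∷ + 1296 / 1 ∷ + 6624 / 5 ∷ + 6192 / 5 ∷ + 6624 / 5 ∷ []) ∷
  (+ 110413 / 120 ∷ + 120781 / 120 ∷ + 23465 / 24 ∷ + 23465 / 24 ∷ + 120781 / 120 ∷ []) ∷
  (+ 3824 / 3 ∷ + 19552 / 15 ∷ + 18256 / 15 ∷ + 19552 / 15 ∷ + 3824 / 3 ∷ []) ∷
  (+ 47727 / 40 ∷ + 9315 / 8 ∷ + 9315 / 8 ∷ + 47727 / 40 ∷ + 44271 / 40 ∷ []) ∷
  (+ 18152 / 15 ∷ + 16856 / 15 ∷ + 18152 / 15 ∷ + 3544 / 3 ∷ + 3544 / 3 ∷ []) ∷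
  (+ 25705 / 24 ∷ + 25705 / 24 ∷ + 131981 / 120 ∷ + 121613 / 120 ∷ + 131981 / 120 ∷ []) ∷
  (+ 6192 / 5 ∷ + 6624 / 5 ∷ + 1296 / 1 ∷ + 1296 / 1 ∷ + 6624 / 5 ∷ []) ∷
  (+ 25193 / 24 ∷ + 129421 / 120 ∷ + 119053 / 120 ∷ + 129421 / 120 ∷ + 25193 / 24 ∷ []) ∷
  (+ 19552 / 15 ∷ + 3824 / 3 ∷ + 3824 / 3 ∷ + 19552 / 15 ∷ + 18256 / 15 ∷ []) ∷
  (+ 44847 / 40 ∷ + 41391 / 40 ∷ + 44847 / 40 ∷ + 8739 / 8 ∷ + 8739 / 8 ∷ []) ∷
  (+ 3544 / 3 ∷ + 3544 / 3 ∷ + 18152 / 15 ∷ + 16856 / 15 ∷ + 18152 / 15 ∷ []) ∷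
  (+ 130253 / 120 ∷ + 140621 / 120 ∷ + 27433 / 24 ∷ + 27433 / 24 ∷ + 140621 / 120 ∷ []) ∷ []

-- remQuot 12 sends 12k + r to (k , r).
c₀ : ℕ → ℚ
c₀ t = let (k , r) = remQuot {5} 12 (t mod 60) in lookup (lookup c₀-table r) k

{-# OPTIONS --safe #-}
-- Row and column permutations and transposition form a group of order 72 acting freely on the squares.
-- Each orbit contains exactly one square with smallest entry top left, first row and column increasing in
-- their last two places, and second entry of the first row below that of the first column. In the gaps
-- between suitable entries such a square is a point of the positive orthant, and it is semimagic unless the
-- point lies on one of seven hyperplanes, each of which expresses one coordinate through the others. Removing
-- the hyperplanes one at a time turns the count into a signed sum of series x^c / Π (1 - x^wᵢ), whose sum is
-- the stated rational function.
--
-- As the denominator divides (1 - x^60)^6, the sixth difference of Sc with step 60 vanishes, just like that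
-- of any quasipolynomial of degree 5 and period 60, so the formula need only be compared at t = 1, …, 360.
-- A constituent is determined by infinitely many values, and the value of c₀ at t ≡ 1 (mod 60) is taken
-- nowhere else, so no period is smaller than 60.
module Submission where

open import Defs
open import Data.Empty using (⊥-elim)
open import Data.Fin.Base as Fin using (Fin; toℕ; fromℕ<; remQuot)
open import Data.Fin.Patterns
import Data.Fin.Properties as Fin
open import Data.Integer.Base as ℤ using (ℤ; +_; -[1+_]; 0ℤ; 1ℤ; -1ℤ)
import Data.Integer.Properties as ℤ
import Data.Integer.Solver as ℤ
open import Data.List.Base as List using (List; []; _∷_)
import Data.List.Properties as List
open import Data.Nat.Base as ℕ using (ℕ; zero; suc; pred; _≤_; _<_; _≥_; _%_; NonZero)
open import Data.Nat.Divisibility using (_∣_; _∤_; divides; m%n≡0⇒n∣m; n∣m⇒m%n≡0)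
open import Data.Nat.DivMod
  using (_mod_; m%n<n; m%n%n≡m%n; [m+n]%n≡m%n; %-remove-+ˡ; %-remove-+ʳ; m∣n⇒o%n%m≡o%m)
open import Data.Nat.Induction using (<-rec)
import Data.Nat.Properties as ℕ
import Data.Nat.Solver as ℕ
open import Data.Product.Base using (∃-syntax; _×_; _,_; proj₁; proj₂)
open import Data.Sum.Base as Sum using (_⊎_; inj₁; inj₂)
open import Data.Vec.Base as Vec using (Vec; []; _∷_; lookup)
import Data.Vec.Properties as Vec
open import Data.Vec.Relation.Unary.All as VecAll using ([]; _∷_)
import Data.Vec.Relation.Unary.All.Properties as VecAll
open import Data.Vec.Relation.Unary.AllPairs using (allPairs?; []; _∷_)
open import Data.Vec.Relation.Unary.Unique.Propositional using () renaming (Unique to UniqueVec)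
import Data.Vec.Relation.Unary.Unique.Propositional.Properties as UniqueVec
open import Function.Base using (id; _∘_)
open import Function.Bundles using (_⇔_; mk⇔; Equivalence)
open import Relation.Binary.Definitions using (DecidableEquality)
open import Relation.Binary.PropositionalEquality
open import Relation.Nullary using (Dec; ¬_; ¬?; yes; no; contradiction)
open import Relation.Nullary.Decidable using (True; False; toWitness; toWitnessFalse)

-- The choice of gaps keeps the exclusions few. All nine entries are linear forms with nonnegative
-- coefficients in five positive gaps; the sixth coordinate is the slack between the largest entry
-- and t. Comparing coefficients orders 29 of the 36 pairs of entries, and the other seven pairs are
-- the hyperplanes. The points on a hyperplane form an orthant with one coordinate fewer, on which
-- every earlier exclusion is again the removal of a graph, follows from the others, or cannot fail.
-- So inclusion-exclusion never runs over all subsets of the seven. Polynomials act on series: one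
-- with constant term 1 can be cancelled, and identities between explicit polynomials are settled by
-- computation. No square is enumerated: the 360 values compared come from dividing out the rational
-- function. The comparison starts at t = 1 because numerator and denominator have equal degree, so
-- that the value at 0 does not fit the quasipolynomial.

-- Formal power series as a module over integer polynomials

module PowerSeries where

  open import Algebra.Properties.CommutativeMonoid.Sum ℤ.+-0-commutativeMonoid using (sum-cong-≗; sum-replicate-zero)
  open import Data.List.Base using (replicate; _++_)
  open import Data.Nat.Base using (_∸_)
  open ℤ.+-*-Solver using (solve; _:+_; _:*_; _:-_; _:=_; con)

  ≈-sym : ∀ {f g} → f ≈ₛ g → g ≈ₛ f
  ≈-sym f≈g n = sym (f≈g n)

  ≈-trans : ∀ {f g h} → f ≈ₛ g → g ≈ₛ h → f ≈ₛ h
  ≈-trans f≈g g≈h n = trans (f≈g n) (g≈h n)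

  0ₛ 1ₛ : Series
  0ₛ _ = 0ℤ
  1ₛ = + 1 ·x^ 0

  infixr 7.5 x·_ _◂_

  x·_ : Series → Series
  (x· s) zero    = 0ℤ
  (x· s) (suc n) = s n

  _◂_ : ℤ → Series → Series
  (c ◂ s) n = c ℤ.* s n

  ⊕-cong : ∀ {f f′ g g′} → f ≈ₛ f′ → g ≈ₛ g′ → f ⊕ g ≈ₛ f′ ⊕ g′
  ⊕-cong f≈ g≈ n = cong₂ ℤ._+_ (f≈ n) (g≈ n)

  ◂-cong : ∀ c {f g} → f ≈ₛ g → c ◂ f ≈ₛ c ◂ g
  ◂-cong c f≈g n = cong (c ℤ.*_) (f≈g n)

  x·-cong : ∀ {f g} → f ≈ₛ g → x· f ≈ₛ x· g
  x·-cong f≈g zero    = refl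
  x·-cong f≈g (suc n) = f≈g n

  -- Integer polynomials as coefficient lists, constant term first, acting on power series.

  Polyℤ : Set
  Polyℤ = List ℤ

  infixr 8 _•_
  infixl 6 _⊞_
  infixl 7 _⊠_

  _•_ : Polyℤ → Series → Series
  []      • s = 0ₛ
  (a ∷ p) • s = a ◂ s ⊕ x· (p • s)

  ⟦_⟧ : Polyℤ → Series
  ⟦ p ⟧ = p • 1ₛ

  _⊞_ : Polyℤ → Polyℤ → Polyℤ
  []      ⊞ q       = q
  (a ∷ p) ⊞ []      = a ∷ p
  (a ∷ p) ⊞ (b ∷ q) = a ℤ.+ b ∷ p ⊞ q

  scale : ℤ → Polyℤ → Polyℤ
  scale c = List.map (c ℤ.*_)

  _⊠_ : Polyℤ → Polyℤ → Polyℤ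
  []      ⊠ q = []
  (a ∷ []) ⊠ q = scale a q
  (a ∷ p@(_ ∷ _)) ⊠ q = scale a q ⊞ (0ℤ ∷ p ⊠ q)

  •-cong : ∀ p {f g} → f ≈ₛ g → p • f ≈ₛ p • g
  •-cong []      f≈g = λ _ → refl
  •-cong (a ∷ p) f≈g = ⊕-cong (◂-cong a f≈g) (x·-cong (•-cong p f≈g))

  •-⊕ : ∀ p f g → p • (f ⊕ g) ≈ₛ p • f ⊕ p • g
  •-⊕ []      f g n       = refl
  •-⊕ (a ∷ p) f g zero    =
    solve 3 (λ a u v → a :* (u :+ v) :+ con 0ℤ := (a :* u :+ con 0ℤ) :+ (a :* v :+ con 0ℤ)) refl a (f 0) (g 0)
  •-⊕ (a ∷ p) f g (suc n) = trans (cong (λ z → a ℤ.* (f (suc n) ℤ.+ g (suc n)) ℤ.+ z) (•-⊕ p f g n))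
    (solve 5 (λ a u v w z → a :* (u :+ v) :+ (w :+ z) := (a :* u :+ w) :+ (a :* v :+ z)) refl a (f (suc n)) (g (suc n)) _ _)

  •-◂ : ∀ p c f → p • (c ◂ f) ≈ₛ c ◂ p • f
  •-◂ []      c f n       = sym (ℤ.*-zeroʳ c)
  •-◂ (a ∷ p) c f zero    = solve 3 (λ a c u → a :* (c :* u) :+ con 0ℤ := c :* (a :* u :+ con 0ℤ)) refl a c (f 0)
  •-◂ (a ∷ p) c f (suc n) = trans (cong (λ z → a ℤ.* (c ℤ.* f (suc n)) ℤ.+ z) (•-◂ p c f n))
    (solve 4 (λ a c u w → a :* (c :* u) :+ c :* w := c :* (a :* u :+ w)) refl a c (f (suc n)) _)

  •-x· : ∀ p f → p • (x· f) ≈ₛ x· (p • f)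
  •-x· []      f zero    = refl
  •-x· []      f (suc n) = refl
  •-x· (a ∷ p) f zero    = cong (ℤ._+ 0ℤ) (ℤ.*-zeroʳ a)
  •-x· (a ∷ p) f (suc n) = cong (ℤ._+_ (a ℤ.* f n)) (•-x· p f n)

  ⊖-as-⊕ : ∀ f g → f ⊖ g ≈ₛ f ⊕ -1ℤ ◂ g
  ⊖-as-⊕ f g n = cong (ℤ._+_ (f n)) (sym (ℤ.-1*i≡-i (g n)))

  •-⊖ : ∀ p f g → p • (f ⊖ g) ≈ₛ p • f ⊖ p • g
  •-⊖ p f g = ≈-trans (•-cong p (⊖-as-⊕ f g)) (≈-trans (•-⊕ p f (-1ℤ ◂ g))
    (≈-trans (⊕-cong {p • f} (λ _ → refl) (•-◂ p -1ℤ g)) (≈-sym (⊖-as-⊕ (p • f) (p • g)))))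

  ⊞-• : ∀ p q f → (p ⊞ q) • f ≈ₛ p • f ⊕ q • f
  ⊞-• []      q       f n       = sym (ℤ.+-identityˡ _)
  ⊞-• (a ∷ p) []      f n       = sym (ℤ.+-identityʳ _)
  ⊞-• (a ∷ p) (b ∷ q) f zero    =
    solve 3 (λ a b u → (a :+ b) :* u :+ con 0ℤ := (a :* u :+ con 0ℤ) :+ (b :* u :+ con 0ℤ)) refl a b (f 0)
  ⊞-• (a ∷ p) (b ∷ q) f (suc n) = trans (cong (ℤ._+_ ((a ℤ.+ b) ℤ.* f (suc n))) (⊞-• p q f n))
    (solve 5 (λ a b u w z → (a :+ b) :* u :+ (w :+ z) := (a :* u :+ w) :+ (b :* u :+ z)) refl a b (f (suc n)) _ _)

  scale-• : ∀ c p f → scale c p • f ≈ₛ c ◂ p • f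
  scale-• c []      f n       = sym (ℤ.*-zeroʳ c)
  scale-• c (a ∷ p) f zero    = solve 3 (λ a c u → (c :* a) :* u :+ con 0ℤ := c :* (a :* u :+ con 0ℤ)) refl a c (f 0)
  scale-• c (a ∷ p) f (suc n) = trans (cong (ℤ._+_ (c ℤ.* a ℤ.* f (suc n))) (scale-• c p f n))
    (solve 4 (λ a c u w → (c :* a) :* u :+ c :* w := c :* (a :* u :+ w)) refl a c (f (suc n)) _)

  x·-0 : x· 0ₛ ≈ₛ 0ₛ
  x·-0 zero    = refl
  x·-0 (suc n) = refl

  ⊠-• : ∀ p q f → (p ⊠ q) • f ≈ₛ p • q • f
  ⊠-• []                q f n = refl
  ⊠-• (a ∷ [])          q f n = trans (scale-• a q f n)
    (sym (trans (cong (ℤ._+_ (a ℤ.* (q • f) n)) (x·-0 n)) (ℤ.+-identityʳ _)))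
  ⊠-• (a ∷ p@(_ ∷ _)) q f n = trans (⊞-• (scale a q) (0ℤ ∷ p ⊠ q) f n)
    (cong₂ ℤ._+_ (scale-• a q f n) (trans (ℤ.+-identityˡ _) (x·-cong (⊠-• p q f) n)))

  ⊛-cong : ∀ {f f′ g g′} → f ≈ₛ f′ → g ≈ₛ g′ → f ⊛ g ≈ₛ f′ ⊛ g′
  ⊛-cong f≈ g≈ n = sum-cong-≗ {suc n} (λ i → cong₂ ℤ._*_ (f≈ (toℕ i)) (g≈ (n ∸ toℕ i)))

  -- The term i = 0 of the convolution splits off by computation, and the remaining terms are the
  -- convolution with the tail `g`. This and `⟦⟧-⊛` carry the Cauchy product of the statement over
  -- to the action `_•_`.
  ⊛-∷ : ∀ f g s a → f 0 ≡ a → (∀ n → f (suc n) ≡ g n) → f ⊛ s ≈ₛ a ◂ s ⊕ x· (g ⊛ s)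
  ⊛-∷ f g s a f₀ f₊ zero    = cong (λ z → z ℤ.* s 0 ℤ.+ 0ℤ) f₀
  ⊛-∷ f g s a f₀ f₊ (suc n) = cong₂ ℤ._+_ (cong (ℤ._* s (suc n)) f₀)
    (sum-cong-≗ {suc n} (λ i → cong (ℤ._* s (n ∸ toℕ i)) (f₊ (toℕ i))))

  0⊛ : ∀ s → 0ₛ ⊛ s ≈ₛ 0ₛ
  0⊛ s n = sum-replicate-zero (suc n)

  ⟦⟧-⊛ : ∀ p s → ⟦ p ⟧ ⊛ s ≈ₛ p • s
  ⟦⟧-⊛ []      s = 0⊛ s
  ⟦⟧-⊛ (a ∷ p) s = ≈-trans
    (⊛-∷ ⟦ a ∷ p ⟧ ⟦ p ⟧ s a
      (solve 1 (λ a → a :* con 1ℤ :+ con 0ℤ := a) refl a)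
      (λ n → trans (cong (ℤ._+ ⟦ p ⟧ n) (ℤ.*-zeroʳ a)) (ℤ.+-identityˡ _)))
    (⊕-cong {a ◂ s} (λ _ → refl) (x·-cong (⟦⟧-⊛ p s)))

  monomial : ℤ → ℕ → Polyℤ
  monomial c k = replicate k 0ℤ ++ c ∷ []

  monomial-⟦⟧ : ∀ c k → c ·x^ k ≈ₛ ⟦ monomial c k ⟧
  monomial-⟦⟧ c zero    zero    = solve 1 (λ a → a := a :* con 1ℤ :+ con 0ℤ) refl c
  monomial-⟦⟧ c zero    (suc n) = sym (cong (ℤ._+ 0ℤ) (ℤ.*-zeroʳ c))
  monomial-⟦⟧ c (suc k) zero    = refl
  monomial-⟦⟧ c (suc k) (suc n) = trans (monomial-⟦⟧ c k n) (sym (ℤ.+-identityˡ _))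

  ⊕-⟦⟧ : ∀ {f g p q} → f ≈ₛ ⟦ p ⟧ → g ≈ₛ ⟦ q ⟧ → f ⊕ g ≈ₛ ⟦ p ⊞ q ⟧
  ⊕-⟦⟧ {p = p} {q} f≈ g≈ = ≈-trans (⊕-cong f≈ g≈) (≈-sym (⊞-• p q 1ₛ))

  ⊖-⟦⟧ : ∀ {f g p q} → f ≈ₛ ⟦ p ⟧ → g ≈ₛ ⟦ q ⟧ → f ⊖ g ≈ₛ ⟦ p ⊞ scale -1ℤ q ⟧
  ⊖-⟦⟧ {f} {g} {p} {q} f≈ g≈ = ≈-trans (⊖-as-⊕ f g)
    (⊕-⟦⟧ {p = p} {scale -1ℤ q} f≈ (≈-trans (◂-cong -1ℤ g≈) (≈-sym (scale-• -1ℤ q 1ₛ))))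

  ⊛-⟦⟧ : ∀ {f g p q} → f ≈ₛ ⟦ p ⟧ → g ≈ₛ ⟦ q ⟧ → f ⊛ g ≈ₛ ⟦ p ⊠ q ⟧
  ⊛-⟦⟧ {p = p} {q} f≈ g≈ = ≈-trans (⊛-cong f≈ g≈) (≈-trans (⟦⟧-⊛ p ⟦ q ⟧) (≈-sym (⊠-• p q 1ₛ)))

  dot : List ℤ → List ℤ → ℤ
  dot (a ∷ p) (u ∷ us) = a ℤ.* u ℤ.+ dot p us
  dot _       _        = 0ℤ

  prefix : Series → ℕ → List ℤ
  prefix s zero    = s 0 ∷ []
  prefix s (suc n) = s (suc n) ∷ prefix s n

  dot-prefix : ∀ p s n → dot p (prefix s n) ≡ (p • s) n
  dot-prefix []          s zero    = refl
  dot-prefix []          s (suc n) = refl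
  dot-prefix (a ∷ [])    s zero    = refl
  dot-prefix (a ∷ _ ∷ _) s zero    = refl
  dot-prefix (a ∷ p)     s (suc n) = cong (ℤ._+_ (a ℤ.* s (suc n))) (dot-prefix p s n)

  -- quotientPrefix p s n lists the coefficients n, …, 0 of s / (1 + x p), latest first.

  quotientStep : Polyℤ → ℤ → List ℤ → List ℤ
  quotientStep p a us = a ℤ.- dot p us ∷ us

  quotientPrefix : Polyℤ → Series → ℕ → List ℤ
  quotientPrefix p s zero    = s 0 ∷ []
  quotientPrefix p s (suc n) = quotientStep p (s (suc n)) (quotientPrefix p s n)

  -- Comparing coefficients of x^n expresses `u n` through the earlier ones. This serves twice: to
  -- cancel a divisor with constant term 1, and to compute coefficients of a series known only
  -- through such an equation.
  quotient-unique : ∀ {p s u} → (1ℤ ∷ p) • u ≈ₛ s → ∀ n → prefix u n ≡ quotientPrefix p s n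
  quotient-unique {p} {s} {u} eq zero = cong (_∷ [])
    (trans (solve 1 (λ u → u := con 1ℤ :* u :+ con 0ℤ) refl (u 0)) (eq 0))
  quotient-unique {p} {s} {u} eq (suc n) = cong₂ _∷_
    (trans (solve 2 (λ u w → u := (con 1ℤ :* u :+ w) :- w) refl (u (suc n)) ((p • u) n))
           (cong₂ ℤ._-_ (eq (suc n)) (trans (sym (dot-prefix p u n)) (cong (dot p) ih))))
    ih
    where ih = quotient-unique {p} {s} {u} eq n

  •-cancel : ∀ p {u v} → (1ℤ ∷ p) • u ≈ₛ (1ℤ ∷ p) • v → u ≈ₛ v
  •-cancel p {u} {v} eq n = head-prefix n (trans (quotient-unique {p} {u = u} eq n)
                                     (sym (quotient-unique {p} {u = v} (λ _ → refl) n)))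
    where
    head-prefix : ∀ n → prefix u n ≡ prefix v n → u n ≡ v n
    head-prefix zero    refl′ = cong (λ { (a ∷ _) → a ; [] → 0ℤ }) refl′
    head-prefix (suc n) refl′ = cong (λ { (a ∷ _) → a ; [] → 0ℤ }) refl′

  quotient : Polyℤ → Series → Series
  quotient p s zero    = s 0
  quotient p s (suc n) = s (suc n) ℤ.- dot p (quotientPrefix p s n)

  quotient-prefix : ∀ p s n → prefix (quotient p s) n ≡ quotientPrefix p s n
  quotient-prefix p s zero    = refl
  quotient-prefix p s (suc n) = cong (quotient p s (suc n) ∷_) (quotient-prefix p s n)

  •-quotient : ∀ p s → (1ℤ ∷ p) • quotient p s ≈ₛ s
  •-quotient p s zero    = solve 1 (λ u → con 1ℤ :* u :+ con 0ℤ := u) refl (s 0)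
  •-quotient p s (suc n) = trans
    (cong₂ (λ d e → 1ℤ ℤ.* (s (suc n) ℤ.- d) ℤ.+ e)
      (cong (dot p) (sym (quotient-prefix p s n))) (sym (dot-prefix p (quotient p s) n)))
    (solve 2 (λ u w → con 1ℤ :* (u :- w) :+ w := u) refl (s (suc n)) (dot p (prefix (quotient p s) n)))

open PowerSeries

-- Cardinalities, and generating series of weighted lattice points

module Counting where

  open import Data.List.Base using (_++_; length; filter; allFin; cartesianProduct)
  open import Data.List.Membership.Propositional using (_∈_)
  open import Data.List.Membership.Propositional.Properties
  open import Data.List.Membership.Propositional.Properties.WithK using (unique∧set⇒bag)
  open import Data.List.Relation.Binary.BagAndSetEquality using (∼bag⇒↭)
  open import Data.List.Relation.Binary.Permutation.Propositional.Properties using (↭-length)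
  open import Data.List.Relation.Unary.Any using (here; there)
  open import Data.List.Relation.Unary.All as All using ([]; _∷_)
  import Data.List.Relation.Unary.All.Properties as All
  open import Data.List.Relation.Unary.AllPairs using ([]; _∷_)
  open import Data.List.Relation.Unary.Unique.Propositional using (Unique)
  import Data.List.Relation.Unary.Unique.Propositional.Properties as Unique
  open import Data.Nat.Base using (_+_; _*_)
  open import Data.Vec.Base using (insertAt; removeAt)
  open import Relation.Unary using (Decidable)
  open ℤ.+-*-Solver using (solve; _:+_; _:-_; _:=_)

  private variable
    A B : Set
    k m n : ℕ

  record _HasSize_ {A : Set} (P : A → Set) (n : ℕ) : Set where
    field
      elements : List A
      unique   : Unique elements
      sound    : ∀ {x} → x ∈ elements → P x
      complete : ∀ {x} → P x → x ∈ elements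
      size     : length elements ≡ n

  open _HasSize_

  -- Two repetition-free lists with the same members are permutations of each other.
  size-unique : {P : A → Set} → P HasSize m → P HasSize n → m ≡ n
  size-unique p q = trans (sym (size p)) (trans
    (↭-length (∼bag⇒↭ (unique∧set⇒bag (unique p) (unique q)
      (mk⇔ (complete q ∘ sound p) (complete p ∘ sound q)))))
    (size q))

  map-unique : ∀ {f : A → B} {xs} → (∀ {x y} → x ∈ xs → y ∈ xs → f x ≡ f y → x ≡ y) →
               Unique xs → Unique (List.map f xs)
  map-unique inj []       = []
  map-unique inj (x∉ ∷ u) =
    All.map⁺ (All.tabulate λ y∈ fx≡fy → All.lookup x∉ y∈ (inj (here refl) (there y∈) fx≡fy))
    ∷ map-unique (λ x∈ y∈ → inj (there x∈) (there y∈)) u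

  size-image : {P : A → Set} {Q : B → Set} (φ : A → B) →
               (∀ {x y} → P x → P y → φ x ≡ φ y → x ≡ y) →
               (∀ {x} → P x → Q (φ x)) → (∀ {y} → Q y → ∃[ x ] P x × φ x ≡ y) →
               P HasSize n → Q HasSize n
  size-image {Q = Q} φ inj to from p = record
    { elements = List.map φ (elements p)
    ; unique   = map-unique (λ x∈ y∈ → inj (sound p x∈) (sound p y∈)) (unique p)
    ; sound    = λ y∈ → let x , x∈ , y≡ = ∈-map⁻ φ y∈ in subst Q (sym y≡) (to (sound p x∈))
    ; complete = λ q → let x , px , φx≡y = from q in subst (_∈ _) φx≡y (∈-map⁺ φ (complete p px))
    ; size     = trans (List.length-map φ (elements p)) (size p)
    }

  size-resp : {P Q : A → Set} → (∀ {x} → P x → Q x) → (∀ {x} → Q x → P x) →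
              P HasSize n → Q HasSize n
  size-resp to from = size-image id (λ _ _ → id) to (λ {y} q → y , from q , refl)

  size-∅ : {P : A → Set} → (∀ {x} → ¬ P x) → P HasSize 0
  size-∅ ¬p = record
    { elements = [] ; unique = [] ; sound = λ () ; complete = λ p → ⊥-elim (¬p p) ; size = refl }

  size-⊎ : {P Q : A → Set} → (∀ {x} → P x → ¬ Q x) → P HasSize m → Q HasSize n →
           (λ x → P x ⊎ Q x) HasSize (m + n)
  size-⊎ disjoint p q = record
    { elements = elements p ++ elements q
    ; unique   = Unique.++⁺ (unique p) (unique q) (λ (x∈p , x∈q) → disjoint (sound p x∈p) (sound q x∈q))
    ; sound    = λ x∈ → Sum.map (sound p) (sound q) (∈-++⁻ (elements p) x∈)
    ; complete = λ { (inj₁ px) → ∈-++⁺ˡ (complete p px) ; (inj₂ qx) → ∈-++⁺ʳ (elements p) (complete q qx) }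
    ; size     = trans (List.length-++ (elements p)) (cong₂ _+_ (size p) (size q))
    }

  size-filter : {P E : A → Set} (E? : Decidable E) (p : P HasSize n) →
                (λ x → P x × E x) HasSize length (filter E? (elements p))
  size-filter E? p = record
    { elements = filter E? (elements p)
    ; unique   = Unique.filter⁺ E? (unique p)
    ; sound    = λ x∈ → let x∈p , e = ∈-filter⁻ E? {xs = elements p} x∈ in sound p x∈p , e
    ; complete = λ (px , e) → ∈-filter⁺ E? (complete p px) e
    ; size     = refl
    }

  -- Filtering enumerates the complement. The sizes add up because `P` reassembled from its two
  -- parts is `P` again and sizes are unique.
  size-∖ : {P E : A → Set} → Decidable E → P HasSize m → (λ x → P x × E x) HasSize k →
           ∃[ n ] (λ x → P x × ¬ E x) HasSize n × n + k ≡ m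
  size-∖ {P = P} {E} E? p pe = _ , rest , size-unique whole p
    where
    rest  = size-filter (¬? ∘ E?) p
    split : ∀ {x} → P x → (P x × ¬ E x) ⊎ (P x × E x)
    split {x} px with E? x
    ... | yes e = inj₂ (px , e)
    ... | no ¬e = inj₁ (px , ¬e)
    whole = size-resp (λ { (inj₁ (px , _)) → px ; (inj₂ (px , _)) → px }) split
              (size-⊎ (λ (_ , ¬e) (_ , e) → ¬e e) rest pe)

  length-cartesianProduct : ∀ (xs : List A) (ys : List B) →
                            length (cartesianProduct xs ys) ≡ length xs * length ys
  length-cartesianProduct []       ys = refl
  length-cartesianProduct (x ∷ xs) ys = trans (List.length-++ (List.map (x ,_) ys))
    (cong₂ _+_ (List.length-map (x ,_) ys) (length-cartesianProduct xs ys))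

  size-Fin× : {P : A → Set} → P HasSize n → (λ ((_ , x) : Fin k × A) → P x) HasSize (k * n)
  size-Fin× {k = k} p = record
    { elements = cartesianProduct (allFin k) (elements p)
    ; unique   = Unique.cartesianProduct⁺ (Unique.allFin⁺ k) (unique p)
    ; sound    = λ ix∈ → sound p (proj₂ (∈-cartesianProduct⁻ (allFin k) (elements p) ix∈))
    ; complete = λ {(i , x)} px → ∈-cartesianProduct⁺ (∈-allFin i) (complete p px)
    ; size     = trans (length-cartesianProduct (allFin k) (elements p))
                   (cong₂ _*_ (List.length-tabulate {n = k} id) (size p))
    }

  -- Q is a fundamental domain in P for the cyclic group generated by σ.

  size-×2 : {P Q : A → Set} (σ : A → A) → (∀ {x} → P x → σ (σ x) ≡ x) →
            (∀ {x} → P x → P (σ x)) → (∀ {x} → Q x → P x) →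
            (∀ {x} → P x → Q x ⊎ Q (σ x)) → (∀ {x} → Q x → ¬ Q (σ x)) →
            Q HasSize n → P HasSize (2 * n)
  size-×2 {A = A} {P = P} {Q} σ σσ closed Q⊆P cover disjoint q =
    size-image τ inj (λ {x} → to {x}) from (size-Fin× {k = 2} q)
    where
    τ : Fin 2 × A → A
    τ (0F , x) = x
    τ (1F , x) = σ x

    inj : ∀ {x y} → Q (proj₂ x) → Q (proj₂ y) → τ x ≡ τ y → x ≡ y
    inj {0F , _} {0F , _} _  _  refl = refl
    inj {0F , _} {1F , _} qx qy refl = ⊥-elim (disjoint qy qx)
    inj {1F , _} {0F , _} qx qy refl = ⊥-elim (disjoint qx qy)
    inj {1F , _} {1F , _} qx qy eq   = cong (1F ,_)
      (trans (sym (σσ (Q⊆P qx))) (trans (cong σ eq) (σσ (Q⊆P qy))))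

    to : ∀ {x} → Q (proj₂ x) → P (τ x)
    to {0F , _} = Q⊆P
    to {1F , _} = closed ∘ Q⊆P

    from : ∀ {y} → P y → ∃[ x ] Q (proj₂ x) × τ x ≡ y
    from {y} py with cover py
    ... | inj₁ qy  = (0F , y) , qy , refl
    ... | inj₂ qσy = (1F , σ y) , qσy , σσ py

  size-×3 : {P Q : A → Set} (σ : A → A) → (∀ {x} → P x → σ (σ (σ x)) ≡ x) →
            (∀ {x} → P x → P (σ x)) → (∀ {x} → Q x → P x) →
            (∀ {x} → P x → Q x ⊎ Q (σ x) ⊎ Q (σ (σ x))) →
            (∀ {x} → Q x → ¬ Q (σ x)) → (∀ {x} → Q x → ¬ Q (σ (σ x))) →
            Q HasSize n → P HasSize (3 * n)
  size-×3 {A = A} {P = P} {Q} σ σσσ closed Q⊆P cover disjoint₁ disjoint₂ q =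
    size-image τ inj (λ {x} → to {x}) from (size-Fin× {k = 3} q)
    where
    τ : Fin 3 × A → A
    τ (0F , x) = x
    τ (1F , x) = σ x
    τ (2F , x) = σ (σ x)

    σ-inj : ∀ {x y} → P x → P y → σ x ≡ σ y → x ≡ y
    σ-inj px py eq = trans (sym (σσσ px)) (trans (cong (σ ∘ σ) eq) (σσσ py))

    inj : ∀ {x y} → Q (proj₂ x) → Q (proj₂ y) → τ x ≡ τ y → x ≡ y
    inj {0F , _} {0F , _} _  _  refl = refl
    inj {0F , _} {1F , _} qx qy refl = ⊥-elim (disjoint₁ qy qx)
    inj {0F , _} {2F , _} qx qy refl = ⊥-elim (disjoint₂ qy qx)
    inj {1F , _} {0F , _} qx qy refl = ⊥-elim (disjoint₁ qx qy)
    inj {1F , _} {1F , _} qx qy eq   = cong (1F ,_) (σ-inj (Q⊆P qx) (Q⊆P qy) eq)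
    inj {1F , _} {2F , _} qx qy eq   =
      ⊥-elim (disjoint₁ qy (subst Q (σ-inj (Q⊆P qx) (closed (Q⊆P qy)) eq) qx))
    inj {2F , _} {0F , _} qx qy refl = ⊥-elim (disjoint₂ qx qy)
    inj {2F , _} {1F , _} qx qy eq   =
      ⊥-elim (disjoint₁ qx (subst Q (sym (σ-inj (closed (Q⊆P qx)) (Q⊆P qy) eq)) qy))
    inj {2F , _} {2F , _} qx qy eq   = cong (2F ,_)
      (σ-inj (Q⊆P qx) (Q⊆P qy) (σ-inj (closed (Q⊆P qx)) (closed (Q⊆P qy)) eq))

    to : ∀ {x} → Q (proj₂ x) → P (τ x)
    to {0F , _} = Q⊆P
    to {1F , _} = closed ∘ Q⊆P
    to {2F , _} = closed ∘ closed ∘ Q⊆P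

    from : ∀ {y} → P y → ∃[ x ] Q (proj₂ x) × τ x ≡ y
    from {y} py with cover py
    ... | inj₁ qy          = (0F , y) , qy , refl
    -- As `σ` has order three, one step into `Q` is undone by two further steps, and two by one.
    ... | inj₂ (inj₁ qσy)  = (2F , σ y) , qσy , σσσ py
    ... | inj₂ (inj₂ qσσy) = (1F , σ (σ y)) , qσσy , σσσ py

  Counts : (ℕ → A → Set) → Series → Set
  Counts P S = ∀ m → ∃[ n ] P m HasSize n × S m ≡ + n

  infixl 6 _∖_≐_

  _∖_≐_ : (ℕ → A → Set) → (A → ℕ) → (A → ℕ) → ℕ → A → Set
  (P ∖ u ≐ v) m x = P m x × u x ≢ v x

  counts-∖-vacuous : ∀ {P : ℕ → A → Set} {u v S} → (∀ {m} x → P m x → u x ≢ v x) →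
                     Counts P S → Counts (P ∖ u ≐ v) S
  counts-∖-vacuous u≢v P-counts m = let n , p , eq = P-counts m in
    n , size-resp (λ {x} px → px , u≢v x px) proj₁ p , eq

  -- On the removed set coordinate i is the function e of the others, so that set is a copy of Vec ℕ k.
  counts-∖ : ∀ {P : ℕ → Vec ℕ (suc k) → Set} {u v S S′} i (e : Vec ℕ k → ℕ) →
             (∀ y → u (insertAt y i (e y)) ≡ v (insertAt y i (e y))) →
             (∀ x → u x ≡ v x → lookup x i ≡ e (removeAt x i)) →
             Counts (λ m y → P m (insertAt y i (e y))) S′ → Counts P S →
             Counts (P ∖ u ≐ v) (S ⊖ S′)
  counts-∖ {k} {P} {u} {v} {S} {S′} i e on-graph graph Q-counts P-counts m =
    let n′ , q , eq′ = Q-counts m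
        n , p , eq   = P-counts m
        d , r , d+n′ = size-∖ (λ x → u x ℕ.≟ v x) p (pe q)
    in d , r , (begin
      S m ℤ.- S′ m         ≡⟨ cong₂ ℤ._-_ (trans eq (cong +_ (sym d+n′))) eq′ ⟩
      + (d + n′) ℤ.- + n′  ≡⟨ solve 2 (λ a b → (a :+ b) :- b := a) refl (+ d) (+ n′) ⟩
      + d                  ∎)
    where
    open ≡-Reasoning
    φ : Vec ℕ k → Vec ℕ (suc k)
    φ y = insertAt y i (e y)

    pe : ∀ {n} → (λ y → P m (φ y)) HasSize n → (λ x → P m x × u x ≡ v x) HasSize n
    pe = size-image φ
      (λ {x} {y} _ _ eq → trans (sym (Vec.removeAt-insertAt x i (e x)))
        (trans (cong (λ z → removeAt z i) eq) (Vec.removeAt-insertAt y i (e y))))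
      (λ {y} py → py , on-graph y)
      (λ {x} (px , eq) →
        let φx = trans (cong (insertAt (removeAt x i) i) (sym (graph x eq))) (Vec.insertAt-removeAt x i)
        in removeAt x i , subst (P m) (sym φx) px , φx)

  linear : ℕ → Vec ℕ k → Vec ℕ k → ℕ
  linear c []       []      = c
  linear c (w ∷ ws) (n ∷ v) = n * w + linear c ws v

  -- What follows the constant term of 1 - x^w, hence the lowered exponent; meaningful for nonzero w
  -- only.
  -1-tail : ℕ → Polyℤ
  -1-tail w = monomial -1ℤ (pred w)

  1-x^_ : ℕ → Polyℤ
  1-x^ w = 1ℤ ∷ -1-tail w

  -- The series x^c / Π (1 - x^wᵢ).
  coneSeries : ℕ → Vec ℕ k → Series
  coneSeries c []       = + 1 ·x^ c
  coneSeries c (w ∷ ws) = quotient (-1-tail w) (coneSeries c ws)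

  coneDenominator : Vec ℕ k → Polyℤ
  coneDenominator []       = 1ℤ ∷ []
  coneDenominator (w ∷ ws) = coneDenominator ws ⊠ 1-x^ w

  1•_ : ∀ s → (1ℤ ∷ []) • s ≈ₛ s
  (1• s) n = trans (cong (ℤ._+_ (1ℤ ℤ.* s n)) (x·-0 n)) (trans (ℤ.+-identityʳ _) (ℤ.*-identityˡ _))

  coneDenominator-• : ∀ c (ws : Vec ℕ k) → coneDenominator ws • coneSeries c ws ≈ₛ + 1 ·x^ c
  coneDenominator-• c []       = 1• (+ 1 ·x^ c)
  coneDenominator-• c (w ∷ ws) = ≈-trans (⊠-• (coneDenominator ws) (1-x^ w) (coneSeries c (w ∷ ws)))
    (≈-trans (•-cong (coneDenominator ws) (•-quotient (-1-tail w) (coneSeries c ws)))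
             (coneDenominator-• c ws))

  monomial-•-< : ∀ c k s {n} → n < k → (monomial c k • s) n ≡ 0ℤ
  monomial-•-< c (suc k) s {zero}  _            = refl
  monomial-•-< c (suc k) s {suc n} (ℕ.s≤s n<k) = trans (ℤ.+-identityˡ _) (monomial-•-< c k s n<k)

  monomial-•-+ : ∀ c k s n → (monomial c k • s) (k + n) ≡ c ℤ.* s n
  monomial-•-+ c zero    s n = trans (cong (ℤ._+_ (c ℤ.* s n)) (x·-0 n)) (ℤ.+-identityʳ _)
  monomial-•-+ c (suc k) s n = trans (ℤ.+-identityˡ _) (monomial-•-+ c k s n)

  1-x^-< : ∀ w s {n} → n < suc w → ((1-x^ suc w) • s) n ≡ s n
  1-x^-< w s {zero}  _             = trans (ℤ.+-identityʳ _) (ℤ.*-identityˡ _)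
  1-x^-< w s {suc n} (ℕ.s≤s n<w) = trans (cong (ℤ._+_ (1ℤ ℤ.* s (suc n))) (monomial-•-< -1ℤ w s n<w))
    (trans (ℤ.+-identityʳ _) (ℤ.*-identityˡ _))

  1-x^-+ : ∀ w s n → ((1-x^ suc w) • s) (suc w + n) ≡ s (suc w + n) ℤ.- s n
  1-x^-+ w s n = trans (cong (ℤ._+_ (1ℤ ℤ.* s (suc w + n))) (monomial-•-+ -1ℤ w s n))
    (cong₂ ℤ._+_ (ℤ.*-identityˡ (s (suc w + n))) (ℤ.-1*i≡-i (s n)))

  x^-diagonal : ∀ a c → (a ·x^ c) c ≡ a
  x^-diagonal a zero    = refl
  x^-diagonal a (suc c) = x^-diagonal a c

  x^-off-diagonal : ∀ a c n → c ≢ n → (a ·x^ c) n ≡ 0ℤ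
  x^-off-diagonal a zero    zero    c≢n = ⊥-elim (c≢n refl)
  x^-off-diagonal a zero    (suc n) c≢n = refl
  x^-off-diagonal a (suc c) zero    c≢n = refl
  x^-off-diagonal a (suc c) (suc n) c≢n = x^-off-diagonal a c n (c≢n ∘ cong suc)

  -- A point of level m has first coordinate 0 or arises by raising that coordinate from a point of
  -- level m - w. This is the coefficient recurrence of division by 1 - x^w, so the induction is on
  -- the weights and, inside, on m.
  counts-linear : ∀ c {ws : Vec ℕ k} → VecAll.All NonZero ws →
                  Counts (λ m v → linear c ws v ≡ m) (coneSeries c ws)
  counts-linear c [] m with c ℕ.≟ m
  ... | yes refl = 1 , point , x^-diagonal (+ 1) c
    where
    point : (λ v → linear c [] v ≡ c) HasSize 1
    point = record
      { elements = [] ∷ [] ; unique = [] ∷ [] ; sound = λ { (here refl) → refl }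
      ; complete = λ { {[]} _ → here refl } ; size = refl }
  ... | no c≢m   = 0 , size-∅ (λ { {[]} → c≢m }) , x^-off-diagonal (+ 1) c m c≢m
  counts-linear {suc k} c {suc w ∷ ws} (_ ∷ ws≢0) = <-rec _ step
    where
    S = coneSeries c (suc w ∷ ws)
    Point : ℕ → Vec ℕ (suc k) → Set
    Point m v = linear c (suc w ∷ ws) v ≡ m

    step : ∀ m → (∀ {m′} → m′ < m → ∃[ n ] Point m′ HasSize n × S m′ ≡ + n) →
           ∃[ n ] Point m HasSize n × S m ≡ + n
    step m rec with m ℕ.<? suc w | counts-linear c ws≢0 m
    ... | yes m<w | n , p , eq = n , base ,
      trans (sym (1-x^-< w S m<w)) (trans (•-quotient (-1-tail (suc w)) (coneSeries c ws) m) eq)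
      where
      base : Point m HasSize n
      base = size-image (0 ∷_) (λ _ _ → Vec.∷-injectiveʳ) id
        (λ { {zero ∷ v} q → v , q , refl
           ; {suc i ∷ v} q → ⊥-elim (ℕ.<⇒≱ m<w
               (subst (suc w ≤_) (trans (sym (ℕ.+-assoc (suc w) (i * suc w) _)) q) (ℕ.m≤m+n (suc w) _))) }) p
    ... | no m≮w | n , p , eq with ℕ.m≤n⇒∃[o]m+o≡n (ℕ.≮⇒≥ m≮w)
    ...   | r , refl with rec {r} (ℕ.m<n+m r ℕ.z<s)
    ...     | n′ , p′ , eq′ = n + n′ , both , (begin
              S (suc w + r)                                ≡⟨ solve 2 (λ a b → a := (a :- b) :+ b) refl _ (S r) ⟩
              (S (suc w + r) ℤ.- S r) ℤ.+ S r              ≡⟨ cong (ℤ._+ S r) (sym (1-x^-+ w S r)) ⟩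
              ((1-x^ suc w) • S) (suc w + r) ℤ.+ S r
                ≡⟨ cong₂ ℤ._+_ (trans (•-quotient (-1-tail (suc w)) (coneSeries c ws) (suc w + r)) eq) eq′ ⟩
              + n ℤ.+ + n′                                 ∎)
      where
      open ≡-Reasoning
      first : (λ v → Point (suc w + r) v × Vec.head v ≡ 0) HasSize n
      first = size-image (0 ∷_) (λ _ _ → Vec.∷-injectiveʳ) (_, refl)
        (λ { {zero ∷ v} (q , _) → v , q , refl }) p
      increment : Vec ℕ (suc k) → Vec ℕ (suc k)
      increment (i ∷ v) = suc i ∷ v
      increment-injective : ∀ {x y} → increment x ≡ increment y → x ≡ y
      increment-injective {_ ∷ _} {_ ∷ _} refl = refl
      later : (λ v → Point (suc w + r) v × Vec.head v ≢ 0) HasSize n′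
      later = size-image increment (λ _ _ → increment-injective)
        (λ { {i ∷ v} q → trans (ℕ.+-assoc (suc w) (i * suc w) _) (cong (_+_ (suc w)) q) , λ () })
        (λ { {zero ∷ v} (q , h) → ⊥-elim (h refl)
           ; {suc i ∷ v} (q , _) → (i ∷ v)
               , ℕ.+-cancelˡ-≡ (suc w) _ _ (trans (sym (ℕ.+-assoc (suc w) (i * suc w) _)) q) , refl }) p′
      split : ∀ {v} → Point (suc w + r) v →
              (Point (suc w + r) v × Vec.head v ≡ 0) ⊎ (Point (suc w + r) v × Vec.head v ≢ 0)
      split {v} q with Vec.head v ℕ.≟ 0
      ... | yes h = inj₁ (q , h)
      ... | no ¬h = inj₂ (q , ¬h)
      both : Point (suc w + r) HasSize (n + n′)
      both = size-resp (λ { (inj₁ (q , _)) → q ; (inj₂ (q , _)) → q }) (λ {v} → split {v})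
               (size-⊎ {P = λ v → Point (suc w + r) v × Vec.head v ≡ 0} (λ (_ , h) (_ , ¬h) → ¬h h) first later)

open Counting

-- Counting the orthant points off the seven hyperplanes

module NormalForms where

  open import Data.Nat.Base using (_+_; _*_)
  open ℕ.+-*-Solver using (Polynomial; solve; _:+_; _:*_; _:=_; con)

  private variable
    k : ℕ

  -- The point (l , a , f , i , j , k) stands for positive integers one larger; writing A, F, I, J, K
  -- for the last five of these, it encodes the semimagic square
  --   A           A+F+I       A+F+I+2J+K
  --   A+F+I+J     A+F+J+K     A+I
  --   A+F+I+J+K   A+I+J       A+F
  -- with entries below its weight. The first entry is the smallest and the third the largest.
  weight : Vec ℕ 6 → ℕ
  weight (l ∷ a ∷ f ∷ i ∷ j ∷ k ∷ []) = suc l + (suc a + (suc f + (suc i + (2 * suc j + suc k))))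

  f̂ î ĵ k̂ : Vec ℕ 6 → ℕ
  f̂ x = lookup x 2F
  î x = lookup x 3F
  ĵ x = lookup x 4F
  k̂ x = lookup x 5F

  -- Each ∖ rules out one of the coincidences of entries that the order relations permit.
  Sized Distinct₁ Distinct₂ Distinct₃ Distinct₄ Distinct₅ Distinct₆ Good : ℕ → Vec ℕ 6 → Set
  Sized m x = weight x ≡ m
  Distinct₁ = Sized     ∖ î ≐ k̂
  Distinct₂ = Distinct₁ ∖ î ≐ (λ x → ĵ x + suc (k̂ x))
  Distinct₃ = Distinct₂ ∖ f̂ ≐ î
  Distinct₄ = Distinct₃ ∖ f̂ ≐ ĵ
  Distinct₅ = Distinct₄ ∖ f̂ ≐ (λ x → î x + suc (ĵ x))
  Distinct₆ = Distinct₅ ∖ î ≐ (λ x → f̂ x + suc (k̂ x))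
  Good      = Distinct₆ ∖ î ≐ (λ x → f̂ x + suc (ĵ x) + suc (k̂ x))

  counts-cone : ∀ c (ws : Vec ℕ k) → {True (VecAll.all? ℕ.nonZero? ws)} → {wt : Vec ℕ k → ℕ} →
                (∀ y → wt y ≡ linear c ws y) →
                Counts (λ m y → wt y ≡ m) (coneSeries c ws)
  counts-cone c ws {ws≢0} wt≡ m = let n , p , eq = counts-linear c (toWitness ws≢0) m in
    n , size-resp (trans (wt≡ _)) (trans (sym (wt≡ _))) p , eq

  -- The superscript ᵖ marks the ring solver's syntax for a function.

  weightᵖ : ∀ {n} (l a f i j k : Polynomial n) → Polynomial n
  weightᵖ l a f i j k = s l :+ (s a :+ (s f :+ (s i :+ (con 2 :* s j :+ s k))))
    where
    s : ∀ {n} → Polynomial n → Polynomial n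
    s p = con 1 :+ p

  linearᵖ : ∀ {k n} → ℕ → Vec ℕ k → Vec (Polynomial n) k → Polynomial n
  linearᵖ c []       []      = con c
  linearᵖ c (w ∷ ws) (x ∷ v) = x :* con w :+ linearᵖ c ws v

  infixl 6 _:+1+_
  _:+1+_ : ∀ {n} → Polynomial n → Polynomial n → Polynomial n
  p :+1+ q = p :+ (con 1 :+ q)

  n≢m+1+n : ∀ m {n} → n ≢ m + suc n
  n≢m+1+n m {n} eq = ℕ.m≢1+n+m n (trans eq (ℕ.+-suc m n))

  m≢m+1+n : ∀ m {n} → m ≢ m + suc n
  m≢m+1+n m eq = ℕ.m+1+n≢m m (sym eq)

  1+-cancelʳ : ∀ m n {o} → m + suc o ≡ n + suc o → m ≡ n
  1+-cancelʳ m n {o} = ℕ.+-cancelʳ-≡ (suc o) m n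

  -- Rₙ counts the points that Distinctₙ (or Good, for n = 7) excludes and the earlier conditions allow.
  allSeries R₁ R₂ R₃ R₄ R₅ R₆ R₇ : Series
  allSeries = coneSeries 7 (1 ∷ 1 ∷ 1 ∷ 1 ∷ 2 ∷ 1 ∷ [])
  R₁ = coneSeries 7 (1 ∷ 1 ∷ 1 ∷ 2 ∷ 2 ∷ [])
  R₂ = coneSeries 8 (1 ∷ 1 ∷ 1 ∷ 3 ∷ 2 ∷ [])
  R₃ = coneSeries 7 (1 ∷ 1 ∷ 2 ∷ 2 ∷ 1 ∷ [])
     ⊖ coneSeries 7 (1 ∷ 1 ∷ 3 ∷ 2 ∷ []) ⊖ coneSeries 9 (1 ∷ 1 ∷ 4 ∷ 3 ∷ [])
  R₄ = coneSeries 7 (1 ∷ 1 ∷ 1 ∷ 3 ∷ 1 ∷ []) ⊖ coneSeries 7 (1 ∷ 1 ∷ 2 ∷ 3 ∷ [])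
     ⊖ coneSeries 8 (1 ∷ 1 ∷ 4 ∷ 2 ∷ []) ⊖ (coneSeries 7 (1 ∷ 1 ∷ 4 ∷ 1 ∷ []) ⊖ coneSeries 7 (1 ∷ 1 ∷ 5 ∷ []))
  R₅ = coneSeries 8 (1 ∷ 1 ∷ 2 ∷ 3 ∷ 1 ∷ [])
     ⊖ coneSeries 8 (1 ∷ 1 ∷ 3 ∷ 3 ∷ []) ⊖ coneSeries 10 (1 ∷ 1 ∷ 5 ∷ 3 ∷ [])
  R₆ = coneSeries 8 (1 ∷ 1 ∷ 2 ∷ 2 ∷ 2 ∷ []) ⊖ coneSeries 8 (1 ∷ 1 ∷ 4 ∷ 2 ∷ [])
  R₇ = coneSeries 9 (1 ∷ 1 ∷ 2 ∷ 3 ∷ 2 ∷ []) ⊖ coneSeries 9 (1 ∷ 1 ∷ 5 ∷ 2 ∷ [])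

  counts-all : Counts Sized allSeries
  counts-all = counts-cone 7 (1 ∷ 1 ∷ 1 ∷ 1 ∷ 2 ∷ 1 ∷ []) {wt = weight}
    (λ { (l ∷ a ∷ f ∷ i ∷ j ∷ k ∷ []) →
      solve 6 (λ l a f i j k → weightᵖ l a f i j k
        := linearᵖ 7 (1 ∷ 1 ∷ 1 ∷ 1 ∷ 2 ∷ 1 ∷ []) (l ∷ a ∷ f ∷ i ∷ j ∷ k ∷ [])) refl l a f i j k })

  f≢f+j+k+j : ∀ f j k → f ≢ f + suc j + suc k + suc j
  f≢f+j+k+j f j k eq = m≢m+1+n f (trans eq
    (solve 3 (λ f j k → f :+1+ j :+1+ k :+1+ j := f :+1+ (j :+1+ k :+1+ j)) refl f j k))

  counts-distinct₁ : Counts Distinct₁ (allSeries ⊖ R₁)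
  counts-distinct₁ = counts-∖ 5F (λ { (_ ∷ _ ∷ _ ∷ i ∷ _ ∷ []) → i })
    (λ { (_ ∷ _ ∷ _ ∷ _ ∷ _ ∷ []) → refl })
    (λ { (_ ∷ _ ∷ _ ∷ _ ∷ _ ∷ _ ∷ []) → sym })
    (counts-cone 7 (1 ∷ 1 ∷ 1 ∷ 2 ∷ 2 ∷ [])
      (λ { (l ∷ a ∷ f ∷ i ∷ j ∷ []) →
        solve 5 (λ l a f i j → weightᵖ l a f i j i
          := linearᵖ 7 (1 ∷ 1 ∷ 1 ∷ 2 ∷ 2 ∷ []) (l ∷ a ∷ f ∷ i ∷ j ∷ [])) refl l a f i j }))
    counts-all

  -- The removed points still have to satisfy the earlier exclusions, rewritten by the substitution.
  -- The nested calls treat these from the latest (outermost) to the earliest: as vacuous where the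
  -- substitution makes the coincidence impossible, as a further graph where it does not. The
  -- innermost cone has the weights of `weight` after substitution, and its constant is 7 plus the
  -- contribution of each substituted `suc`.
  counts-distinct₂ : Counts Distinct₂ (allSeries ⊖ R₁ ⊖ R₂)
  counts-distinct₂ = counts-∖ 3F (λ { (_ ∷ _ ∷ _ ∷ j ∷ k ∷ []) → j + suc k })
    (λ { (_ ∷ _ ∷ _ ∷ _ ∷ _ ∷ []) → refl })
    (λ { (_ ∷ _ ∷ _ ∷ _ ∷ _ ∷ _ ∷ []) → id })
    (counts-∖-vacuous (λ { (_ ∷ _ ∷ f ∷ j ∷ k ∷ []) _ → n≢m+1+n j ∘ sym })
      (counts-cone 8 (1 ∷ 1 ∷ 1 ∷ 3 ∷ 2 ∷ [])
        (λ { (l ∷ a ∷ f ∷ j ∷ k ∷ []) →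
          solve 5 (λ l a f j k → weightᵖ l a f (j :+1+ k) j k
            := linearᵖ 8 (1 ∷ 1 ∷ 1 ∷ 3 ∷ 2 ∷ []) (l ∷ a ∷ f ∷ j ∷ k ∷ [])) refl l a f j k })))
    counts-distinct₁

  counts-distinct₃ : Counts Distinct₃ (allSeries ⊖ R₁ ⊖ R₂ ⊖ R₃)
  counts-distinct₃ = counts-∖ 2F (λ { (_ ∷ _ ∷ i ∷ _ ∷ _ ∷ []) → i })
    (λ { (_ ∷ _ ∷ _ ∷ _ ∷ _ ∷ []) → refl })
    (λ { (_ ∷ _ ∷ _ ∷ _ ∷ _ ∷ _ ∷ []) → id })
    (counts-∖ 2F (λ { (_ ∷ _ ∷ j ∷ k ∷ []) → j + suc k })
      (λ { (_ ∷ _ ∷ _ ∷ _ ∷ []) → refl })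
      (λ { (_ ∷ _ ∷ _ ∷ _ ∷ _ ∷ []) → id })
      (counts-∖-vacuous (λ { (_ ∷ _ ∷ j ∷ k ∷ []) _ → n≢m+1+n j ∘ sym })
        (counts-cone 9 (1 ∷ 1 ∷ 4 ∷ 3 ∷ [])
          (λ { (l ∷ a ∷ j ∷ k ∷ []) →
            solve 4 (λ l a j k → weightᵖ l a (j :+1+ k) (j :+1+ k) j k
              := linearᵖ 9 (1 ∷ 1 ∷ 4 ∷ 3 ∷ []) (l ∷ a ∷ j ∷ k ∷ [])) refl l a j k })))
      (counts-∖ 4F (λ { (_ ∷ _ ∷ i ∷ _ ∷ []) → i })
        (λ { (_ ∷ _ ∷ _ ∷ _ ∷ []) → refl })
        (λ { (_ ∷ _ ∷ _ ∷ _ ∷ _ ∷ []) → sym })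
        (counts-cone 7 (1 ∷ 1 ∷ 3 ∷ 2 ∷ [])
          (λ { (l ∷ a ∷ i ∷ j ∷ []) →
            solve 4 (λ l a i j → weightᵖ l a i i j i
              := linearᵖ 7 (1 ∷ 1 ∷ 3 ∷ 2 ∷ []) (l ∷ a ∷ i ∷ j ∷ [])) refl l a i j }))
        (counts-cone 7 (1 ∷ 1 ∷ 2 ∷ 2 ∷ 1 ∷ [])
          (λ { (l ∷ a ∷ i ∷ j ∷ k ∷ []) →
            solve 5 (λ l a i j k → weightᵖ l a i i j k
              := linearᵖ 7 (1 ∷ 1 ∷ 2 ∷ 2 ∷ 1 ∷ []) (l ∷ a ∷ i ∷ j ∷ k ∷ [])) refl l a i j k }))))
    counts-distinct₂

  counts-distinct₄ : Counts Distinct₄ (allSeries ⊖ R₁ ⊖ R₂ ⊖ R₃ ⊖ R₄)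
  counts-distinct₄ = counts-∖ 2F (λ { (_ ∷ _ ∷ _ ∷ j ∷ _ ∷ []) → j })
    (λ { (_ ∷ _ ∷ _ ∷ _ ∷ _ ∷ []) → refl })
    (λ { (_ ∷ _ ∷ _ ∷ _ ∷ _ ∷ _ ∷ []) → id })
    -- The exclusion f ≢ i, which on f = j removes i = j. There i ≢ k turns into j ≢ k, a graph once
    -- more, whence the nested difference in `R₄`.
    (counts-∖ 2F (λ { (_ ∷ _ ∷ j ∷ _ ∷ []) → j })
      (λ { (_ ∷ _ ∷ _ ∷ _ ∷ []) → refl })
      (λ { (_ ∷ _ ∷ _ ∷ _ ∷ _ ∷ []) → sym })
      (counts-∖-vacuous (λ { (_ ∷ _ ∷ j ∷ k ∷ []) _ → m≢m+1+n j })
        (counts-∖ 3F (λ { (_ ∷ _ ∷ j ∷ []) → j })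
          (λ { (_ ∷ _ ∷ _ ∷ []) → refl })
          (λ { (_ ∷ _ ∷ _ ∷ _ ∷ []) → sym })
          (counts-cone 7 (1 ∷ 1 ∷ 5 ∷ [])
            (λ { (l ∷ a ∷ j ∷ []) →
              solve 3 (λ l a j → weightᵖ l a j j j j
                := linearᵖ 7 (1 ∷ 1 ∷ 5 ∷ []) (l ∷ a ∷ j ∷ [])) refl l a j }))
          (counts-cone 7 (1 ∷ 1 ∷ 4 ∷ 1 ∷ [])
            (λ { (l ∷ a ∷ j ∷ k ∷ []) →
              solve 4 (λ l a j k → weightᵖ l a j j j k
                := linearᵖ 7 (1 ∷ 1 ∷ 4 ∷ 1 ∷ []) (l ∷ a ∷ j ∷ k ∷ [])) refl l a j k }))))
      (counts-∖ 2F (λ { (_ ∷ _ ∷ j ∷ k ∷ []) → j + suc k })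
        (λ { (_ ∷ _ ∷ _ ∷ _ ∷ []) → refl })
        (λ { (_ ∷ _ ∷ _ ∷ _ ∷ _ ∷ []) → id })
        (counts-∖-vacuous (λ { (_ ∷ _ ∷ j ∷ k ∷ []) _ → n≢m+1+n j ∘ sym })
          (counts-cone 8 (1 ∷ 1 ∷ 4 ∷ 2 ∷ [])
            (λ { (l ∷ a ∷ j ∷ k ∷ []) →
              solve 4 (λ l a j k → weightᵖ l a j (j :+1+ k) j k
                := linearᵖ 8 (1 ∷ 1 ∷ 4 ∷ 2 ∷ []) (l ∷ a ∷ j ∷ k ∷ [])) refl l a j k })))
        (counts-∖ 4F (λ { (_ ∷ _ ∷ i ∷ _ ∷ []) → i })
          (λ { (_ ∷ _ ∷ _ ∷ _ ∷ []) → refl })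
          (λ { (_ ∷ _ ∷ _ ∷ _ ∷ _ ∷ []) → sym })
          (counts-cone 7 (1 ∷ 1 ∷ 2 ∷ 3 ∷ [])
            (λ { (l ∷ a ∷ i ∷ j ∷ []) →
              solve 4 (λ l a i j → weightᵖ l a j i j i
                := linearᵖ 7 (1 ∷ 1 ∷ 2 ∷ 3 ∷ []) (l ∷ a ∷ i ∷ j ∷ [])) refl l a i j }))
          (counts-cone 7 (1 ∷ 1 ∷ 1 ∷ 3 ∷ 1 ∷ [])
            (λ { (l ∷ a ∷ i ∷ j ∷ k ∷ []) →
              solve 5 (λ l a i j k → weightᵖ l a j i j k
                := linearᵖ 7 (1 ∷ 1 ∷ 1 ∷ 3 ∷ 1 ∷ []) (l ∷ a ∷ i ∷ j ∷ k ∷ [])) refl l a i j k })))))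
    counts-distinct₃

  counts-distinct₅ : Counts Distinct₅ (allSeries ⊖ R₁ ⊖ R₂ ⊖ R₃ ⊖ R₄ ⊖ R₅)
  counts-distinct₅ = counts-∖ 2F (λ { (_ ∷ _ ∷ i ∷ j ∷ _ ∷ []) → i + suc j })
    (λ { (_ ∷ _ ∷ _ ∷ _ ∷ _ ∷ []) → refl })
    (λ { (_ ∷ _ ∷ _ ∷ _ ∷ _ ∷ _ ∷ []) → id })
    (counts-∖-vacuous (λ { (_ ∷ _ ∷ i ∷ j ∷ k ∷ []) _ → n≢m+1+n i ∘ sym })
      (counts-∖-vacuous (λ { (_ ∷ _ ∷ i ∷ j ∷ k ∷ []) _ → m≢m+1+n i ∘ sym })
        (counts-∖ 2F (λ { (_ ∷ _ ∷ j ∷ k ∷ []) → j + suc k })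
          (λ { (_ ∷ _ ∷ _ ∷ _ ∷ []) → refl })
          (λ { (_ ∷ _ ∷ _ ∷ _ ∷ _ ∷ []) → id })
          (counts-∖-vacuous (λ { (_ ∷ _ ∷ j ∷ k ∷ []) _ → n≢m+1+n j ∘ sym })
            (counts-cone 10 (1 ∷ 1 ∷ 5 ∷ 3 ∷ [])
              (λ { (l ∷ a ∷ j ∷ k ∷ []) →
                solve 4 (λ l a j k → weightᵖ l a ((j :+1+ k) :+1+ j) (j :+1+ k) j k
                  := linearᵖ 10 (1 ∷ 1 ∷ 5 ∷ 3 ∷ []) (l ∷ a ∷ j ∷ k ∷ [])) refl l a j k })))
          (counts-∖ 4F (λ { (_ ∷ _ ∷ i ∷ _ ∷ []) → i })
            (λ { (_ ∷ _ ∷ _ ∷ _ ∷ []) → refl })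
            (λ { (_ ∷ _ ∷ _ ∷ _ ∷ _ ∷ []) → sym })
            (counts-cone 8 (1 ∷ 1 ∷ 3 ∷ 3 ∷ [])
              (λ { (l ∷ a ∷ i ∷ j ∷ []) →
                solve 4 (λ l a i j → weightᵖ l a (i :+1+ j) i j i
                  := linearᵖ 8 (1 ∷ 1 ∷ 3 ∷ 3 ∷ []) (l ∷ a ∷ i ∷ j ∷ [])) refl l a i j }))
            (counts-cone 8 (1 ∷ 1 ∷ 2 ∷ 3 ∷ 1 ∷ [])
              (λ { (l ∷ a ∷ i ∷ j ∷ k ∷ []) →
                solve 5 (λ l a i j k → weightᵖ l a (i :+1+ j) i j k
                  := linearᵖ 8 (1 ∷ 1 ∷ 2 ∷ 3 ∷ 1 ∷ []) (l ∷ a ∷ i ∷ j ∷ k ∷ [])) refl l a i j k }))))))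
    counts-distinct₄

  counts-distinct₆ : Counts Distinct₆ (allSeries ⊖ R₁ ⊖ R₂ ⊖ R₃ ⊖ R₄ ⊖ R₅ ⊖ R₆)
  counts-distinct₆ = counts-∖ 3F (λ { (_ ∷ _ ∷ f ∷ _ ∷ k ∷ []) → f + suc k })
    (λ { (_ ∷ _ ∷ _ ∷ _ ∷ _ ∷ []) → refl })
    (λ { (_ ∷ _ ∷ _ ∷ _ ∷ _ ∷ _ ∷ []) → id })
    (counts-∖-vacuous (λ { (_ ∷ _ ∷ f ∷ j ∷ k ∷ []) _ → m≢m+1+n f ∘ λ eq → trans eq (ℕ.+-assoc f (suc k) (suc j)) })
      -- After this substitution i ≢ j + suc k and f ≢ j say the same, so once the former holds the
      -- latter removes nothing.
      (counts-∖-vacuous (λ { (_ ∷ _ ∷ _ ∷ _ ∷ k ∷ []) ((_ , f+k≢j+k) , _) → f+k≢j+k ∘ cong (_+ suc k) })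
        (counts-∖-vacuous (λ { (_ ∷ _ ∷ f ∷ j ∷ k ∷ []) _ → m≢m+1+n f })
          (counts-∖ 2F (λ { (_ ∷ _ ∷ j ∷ _ ∷ []) → j })
            (λ { (_ ∷ _ ∷ _ ∷ _ ∷ []) → refl })
            (λ { (_ ∷ _ ∷ f ∷ j ∷ _ ∷ []) → 1+-cancelʳ f j })
            (counts-∖-vacuous (λ { (_ ∷ _ ∷ j ∷ k ∷ []) _ → n≢m+1+n j ∘ sym })
              (counts-cone 8 (1 ∷ 1 ∷ 4 ∷ 2 ∷ [])
                (λ { (l ∷ a ∷ j ∷ k ∷ []) →
                  solve 4 (λ l a j k → weightᵖ l a j (j :+1+ k) j k
                    := linearᵖ 8 (1 ∷ 1 ∷ 4 ∷ 2 ∷ []) (l ∷ a ∷ j ∷ k ∷ [])) refl l a j k })))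
            (counts-∖-vacuous (λ { (_ ∷ _ ∷ f ∷ j ∷ k ∷ []) _ → n≢m+1+n f ∘ sym })
              (counts-cone 8 (1 ∷ 1 ∷ 2 ∷ 2 ∷ 2 ∷ [])
                (λ { (l ∷ a ∷ f ∷ j ∷ k ∷ []) →
                  solve 5 (λ l a f j k → weightᵖ l a f (f :+1+ k) j k
                    := linearᵖ 8 (1 ∷ 1 ∷ 2 ∷ 2 ∷ 2 ∷ []) (l ∷ a ∷ f ∷ j ∷ k ∷ [])) refl l a f j k })))))))
    counts-distinct₅

  counts-good : Counts Good (allSeries ⊖ R₁ ⊖ R₂ ⊖ R₃ ⊖ R₄ ⊖ R₅ ⊖ R₆ ⊖ R₇)
  counts-good = counts-∖ 3F (λ { (_ ∷ _ ∷ f ∷ j ∷ k ∷ []) → f + suc j + suc k })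
    (λ { (_ ∷ _ ∷ _ ∷ _ ∷ _ ∷ []) → refl })
    (λ { (_ ∷ _ ∷ _ ∷ _ ∷ _ ∷ _ ∷ []) → id })
    (counts-∖-vacuous (λ { (_ ∷ _ ∷ f ∷ j ∷ k ∷ []) _ → m≢m+1+n f ∘ sym ∘ 1+-cancelʳ (f + suc j) f })
      (counts-∖-vacuous (λ { (_ ∷ _ ∷ f ∷ j ∷ k ∷ []) _ → f≢f+j+k+j f j k })
        -- Of the six earlier exclusions only f ≢ j can still fail on this hyperplane.
        (counts-∖ 2F (λ { (_ ∷ _ ∷ j ∷ _ ∷ []) → j })
          (λ { (_ ∷ _ ∷ _ ∷ _ ∷ []) → refl })
          (λ { (_ ∷ _ ∷ _ ∷ _ ∷ _ ∷ []) → id })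
          (counts-∖-vacuous (λ { (_ ∷ _ ∷ j ∷ k ∷ []) _ → m≢m+1+n j ∘ λ eq → trans eq (ℕ.+-assoc j (suc j) (suc k)) })
            (counts-∖-vacuous (λ { (_ ∷ _ ∷ j ∷ k ∷ []) _ → n≢m+1+n j ∘ sym ∘ 1+-cancelʳ (j + suc j) j })
              (counts-∖-vacuous (λ { (_ ∷ _ ∷ j ∷ k ∷ []) _ → n≢m+1+n (j + suc j) ∘ sym })
                (counts-cone 9 (1 ∷ 1 ∷ 5 ∷ 2 ∷ [])
                  (λ { (l ∷ a ∷ j ∷ k ∷ []) →
                    solve 4 (λ l a j k → weightᵖ l a j ((j :+1+ j) :+1+ k) j k
                      := linearᵖ 9 (1 ∷ 1 ∷ 5 ∷ 2 ∷ []) (l ∷ a ∷ j ∷ k ∷ [])) refl l a j k })))))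
          (counts-∖-vacuous (λ { (_ ∷ _ ∷ f ∷ j ∷ k ∷ []) _ → m≢m+1+n f ∘ λ eq → trans eq (ℕ.+-assoc f (suc j) (suc k)) })
            (counts-∖-vacuous (λ { (_ ∷ _ ∷ f ∷ j ∷ k ∷ []) _ → n≢m+1+n f ∘ sym ∘ 1+-cancelʳ (f + suc j) j })
              (counts-∖-vacuous (λ { (_ ∷ _ ∷ f ∷ j ∷ k ∷ []) _ → n≢m+1+n (f + suc j) ∘ sym })
                (counts-cone 9 (1 ∷ 1 ∷ 2 ∷ 3 ∷ 2 ∷ [])
                  (λ { (l ∷ a ∷ f ∷ j ∷ k ∷ []) →
                    solve 5 (λ l a f j k → weightᵖ l a f ((f :+1+ j) :+1+ k) j k
                      := linearᵖ 9 (1 ∷ 1 ∷ 2 ∷ 3 ∷ 2 ∷ []) (l ∷ a ∷ f ∷ j ∷ k ∷ [])) refl l a f j k }))))))))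
    counts-distinct₆

open NormalForms

-- The signed sum of cone series as a single fraction

module ClosedForm where

  private variable
    k m : ℕ

  infix 4 _≟ₚ_
  _≟ₚ_ : DecidableEquality Polyℤ
  _≟ₚ_ = List.≡-dec ℤ._≟_

  goodSeries : Series
  goodSeries = allSeries ⊖ R₁ ⊖ R₂ ⊖ R₃ ⊖ R₄ ⊖ R₅ ⊖ R₆ ⊖ R₇

  -- Each factor 1 - x^w occurs as often as in the cone that has it most often: five times for w =
  -- 1, three for 2, two for 3, once each for 4 and 5.
  commonDenominator : Polyℤ
  commonDenominator = coneDenominator (1 ∷ 1 ∷ 1 ∷ 1 ∷ 1 ∷ 2 ∷ 2 ∷ 2 ∷ 3 ∷ 3 ∷ 4 ∷ 5 ∷ [])

  record Cleared (S : Series) : Set where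
    field
      numerator : Polyℤ
      cleared   : commonDenominator • S ≈ₛ ⟦ numerator ⟧

  open Cleared

  -- `vs` lists the weights that `ws` lacks; multiplying out confirms that the two together give the
  -- common denominator.
  cleared-cone : ∀ c (ws : Vec ℕ k) (vs : Vec ℕ m) →
                 {True (coneDenominator vs ⊠ coneDenominator ws ≟ₚ commonDenominator)} →
                 Cleared (coneSeries c ws)
  cleared-cone c ws vs {eq} = record
    { numerator = coneDenominator vs ⊠ monomial (+ 1) c
    ; cleared   = ≈-trans (λ n → cong (λ p → (p • coneSeries c ws) n) (sym (toWitness eq)))
        (≈-trans (⊠-• (coneDenominator vs) (coneDenominator ws) (coneSeries c ws))
        (≈-trans (•-cong (coneDenominator vs) (≈-trans (coneDenominator-• c ws) (monomial-⟦⟧ (+ 1) c)))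
                 (≈-sym (⊠-• (coneDenominator vs) (monomial (+ 1) c) 1ₛ))))
    }

  infixl 6 _⊖ᶜ_
  _⊖ᶜ_ : ∀ {S T} → Cleared S → Cleared T → Cleared (S ⊖ T)
  _⊖ᶜ_ {S} {T} s t = record
    { numerator = numerator s ⊞ scale -1ℤ (numerator t)
    ; cleared   = ≈-trans (•-⊖ commonDenominator S T)
                    (⊖-⟦⟧ {p = numerator s} {numerator t} (cleared s) (cleared t))
    }

  cleared-R₁ : Cleared R₁
  cleared-R₁ = cleared-cone 7 (1 ∷ 1 ∷ 1 ∷ 2 ∷ 2 ∷ []) (1 ∷ 1 ∷ 2 ∷ 3 ∷ 3 ∷ 4 ∷ 5 ∷ [])

  cleared-R₂ : Cleared R₂
  cleared-R₂ = cleared-cone 8 (1 ∷ 1 ∷ 1 ∷ 3 ∷ 2 ∷ []) (1 ∷ 1 ∷ 2 ∷ 2 ∷ 3 ∷ 4 ∷ 5 ∷ [])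

  cleared-R₃ : Cleared R₃
  cleared-R₃ = cleared-cone 7 (1 ∷ 1 ∷ 2 ∷ 2 ∷ 1 ∷ []) (1 ∷ 1 ∷ 2 ∷ 3 ∷ 3 ∷ 4 ∷ 5 ∷ [])
    ⊖ᶜ cleared-cone 7 (1 ∷ 1 ∷ 3 ∷ 2 ∷ []) (1 ∷ 1 ∷ 1 ∷ 2 ∷ 2 ∷ 3 ∷ 4 ∷ 5 ∷ [])
    ⊖ᶜ cleared-cone 9 (1 ∷ 1 ∷ 4 ∷ 3 ∷ []) (1 ∷ 1 ∷ 1 ∷ 2 ∷ 2 ∷ 2 ∷ 3 ∷ 5 ∷ [])

  cleared-R₄ : Cleared R₄
  cleared-R₄ = cleared-cone 7 (1 ∷ 1 ∷ 1 ∷ 3 ∷ 1 ∷ []) (1 ∷ 2 ∷ 2 ∷ 2 ∷ 3 ∷ 4 ∷ 5 ∷ [])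
    ⊖ᶜ cleared-cone 7 (1 ∷ 1 ∷ 2 ∷ 3 ∷ []) (1 ∷ 1 ∷ 1 ∷ 2 ∷ 2 ∷ 3 ∷ 4 ∷ 5 ∷ [])
    ⊖ᶜ cleared-cone 8 (1 ∷ 1 ∷ 4 ∷ 2 ∷ []) (1 ∷ 1 ∷ 1 ∷ 2 ∷ 2 ∷ 3 ∷ 3 ∷ 5 ∷ [])
    ⊖ᶜ (cleared-cone 7 (1 ∷ 1 ∷ 4 ∷ 1 ∷ []) (1 ∷ 1 ∷ 2 ∷ 2 ∷ 2 ∷ 3 ∷ 3 ∷ 5 ∷ [])
        ⊖ᶜ cleared-cone 7 (1 ∷ 1 ∷ 5 ∷ []) (1 ∷ 1 ∷ 1 ∷ 2 ∷ 2 ∷ 2 ∷ 3 ∷ 3 ∷ 4 ∷ []))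

  cleared-R₅ : Cleared R₅
  cleared-R₅ = cleared-cone 8 (1 ∷ 1 ∷ 2 ∷ 3 ∷ 1 ∷ []) (1 ∷ 1 ∷ 2 ∷ 2 ∷ 3 ∷ 4 ∷ 5 ∷ [])
    ⊖ᶜ cleared-cone 8 (1 ∷ 1 ∷ 3 ∷ 3 ∷ []) (1 ∷ 1 ∷ 1 ∷ 2 ∷ 2 ∷ 2 ∷ 4 ∷ 5 ∷ [])
    ⊖ᶜ cleared-cone 10 (1 ∷ 1 ∷ 5 ∷ 3 ∷ []) (1 ∷ 1 ∷ 1 ∷ 2 ∷ 2 ∷ 2 ∷ 3 ∷ 4 ∷ [])

  cleared-R₆ : Cleared R₆
  cleared-R₆ = cleared-cone 8 (1 ∷ 1 ∷ 2 ∷ 2 ∷ 2 ∷ []) (1 ∷ 1 ∷ 1 ∷ 3 ∷ 3 ∷ 4 ∷ 5 ∷ [])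
    ⊖ᶜ cleared-cone 8 (1 ∷ 1 ∷ 4 ∷ 2 ∷ []) (1 ∷ 1 ∷ 1 ∷ 2 ∷ 2 ∷ 3 ∷ 3 ∷ 5 ∷ [])

  cleared-R₇ : Cleared R₇
  cleared-R₇ = cleared-cone 9 (1 ∷ 1 ∷ 2 ∷ 3 ∷ 2 ∷ []) (1 ∷ 1 ∷ 1 ∷ 2 ∷ 3 ∷ 4 ∷ 5 ∷ [])
    ⊖ᶜ cleared-cone 9 (1 ∷ 1 ∷ 5 ∷ 2 ∷ []) (1 ∷ 1 ∷ 1 ∷ 2 ∷ 2 ∷ 3 ∷ 3 ∷ 4 ∷ [])

  cleared-goodSeries : Cleared goodSeries
  cleared-goodSeries = cleared-cone 7 (1 ∷ 1 ∷ 1 ∷ 1 ∷ 2 ∷ 1 ∷ []) (2 ∷ 2 ∷ 3 ∷ 3 ∷ 4 ∷ 5 ∷ [])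
    ⊖ᶜ cleared-R₁ ⊖ᶜ cleared-R₂ ⊖ᶜ cleared-R₃ ⊖ᶜ cleared-R₄ ⊖ᶜ cleared-R₅ ⊖ᶜ cleared-R₆ ⊖ᶜ cleared-R₇

  record IsPolynomial (S : Series) : Set where
    field
      coefficients : Polyℤ
      expansion    : S ≈ₛ ⟦ coefficients ⟧

  open IsPolynomial

  infixl 6 _⊕ᵖ_
  infixl 7 _⊛ᵖ_

  x^ᵖ : ∀ c k → IsPolynomial (c ·x^ k)
  x^ᵖ c k = record { coefficients = monomial c k ; expansion = monomial-⟦⟧ c k }

  _⊕ᵖ_ : ∀ {S T} → IsPolynomial S → IsPolynomial T → IsPolynomial (S ⊕ T)
  s ⊕ᵖ t = record { coefficients = coefficients s ⊞ coefficients t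
                  ; expansion    = ⊕-⟦⟧ {p = coefficients s} {coefficients t} (expansion s) (expansion t) }

  _⊛ᵖ_ : ∀ {S T} → IsPolynomial S → IsPolynomial T → IsPolynomial (S ⊛ T)
  s ⊛ᵖ t = record { coefficients = coefficients s ⊠ coefficients t
                  ; expansion    = ⊛-⟦⟧ {p = coefficients s} {coefficients t} (expansion s) (expansion t) }

  1-x^ᵖ_ : ∀ k → IsPolynomial (+ 1 ·x^ 0 ⊖ + 1 ·x^ k)
  1-x^ᵖ k = record { coefficients = monomial (+ 1) 0 ⊞ scale -1ℤ (monomial (+ 1) k)
                   ; expansion    = ⊖-⟦⟧ {p = monomial (+ 1) 0} {monomial (+ 1) k} (monomial-⟦⟧ (+ 1) 0) (monomial-⟦⟧ (+ 1) k) }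

  numeratorᵖ : IsPolynomial ScNumerator
  numeratorᵖ = x^ᵖ (+ 72) 10 ⊛ᵖ
    (x^ᵖ (+ 18) 9 ⊕ᵖ x^ᵖ (+ 46) 8 ⊕ᵖ x^ᵖ (+ 69) 7 ⊕ᵖ x^ᵖ (+ 74) 6 ⊕ᵖ x^ᵖ (+ 65) 5
      ⊕ᵖ x^ᵖ (+ 46) 4 ⊕ᵖ x^ᵖ (+ 26) 3 ⊕ᵖ x^ᵖ (+ 11) 2 ⊕ᵖ x^ᵖ (+ 4) 1 ⊕ᵖ x^ᵖ (+ 1) 0)

  denominatorᵖ : IsPolynomial ScDenominator
  denominatorᵖ = square (1-x^ᵖ 2) ⊛ᵖ square (1-x^ᵖ 3) ⊛ᵖ 1-x^ᵖ 4 ⊛ᵖ 1-x^ᵖ 5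
    where
    square : ∀ {S} → IsPolynomial S → IsPolynomial (S ^ₛ 2)
    square s = s ⊛ᵖ (s ⊛ᵖ x^ᵖ (+ 1) 0)

  -- The stated fraction multiplied out. Literal lists expose the constant term 1 of the
  -- denominator, on which cancellation and division rest.
  numeratorPoly denominatorTail denominatorPoly : Polyℤ
  numeratorPoly   = 0ℤ ∷ 0ℤ ∷ 0ℤ ∷ 0ℤ ∷ 0ℤ ∷ 0ℤ ∷ 0ℤ ∷ 0ℤ ∷ 0ℤ ∷ 0ℤ ∷ + 72 ∷ + 288 ∷ + 792 ∷ + 1872 ∷ + 3312 ∷ + 4680 ∷ + 5328 ∷ + 4968 ∷ + 3312 ∷ + 1296 ∷ []
  denominatorTail = 0ℤ ∷ -[1+ 1 ] ∷ -[1+ 1 ] ∷ 0ℤ ∷ + 3 ∷ + 3 ∷ + 2 ∷ -1ℤ ∷ -[1+ 3 ] ∷ -[1+ 3 ] ∷ -1ℤ ∷ + 2 ∷ + 3 ∷ + 3 ∷ 0ℤ ∷ -[1+ 1 ] ∷ -[1+ 1 ] ∷ 0ℤ ∷ 1ℤ ∷ []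
  denominatorPoly = 1ℤ ∷ denominatorTail

  ScNumerator-⟦⟧ : ScNumerator ≈ₛ ⟦ numeratorPoly ⟧
  ScNumerator-⟦⟧ = ≈-trans (expansion numeratorᵖ)
    (λ n → cong (λ p → ⟦ p ⟧ n) (toWitness {a? = coefficients numeratorᵖ ≟ₚ numeratorPoly} _))

  ScDenominator-⟦⟧ : ScDenominator ≈ₛ ⟦ denominatorPoly ⟧
  ScDenominator-⟦⟧ = ≈-trans (expansion denominatorᵖ)
    (λ n → cong (λ p → ⟦ p ⟧ n) (toWitness {a? = coefficients denominatorᵖ ≟ₚ denominatorPoly} _))

  denominator-•-goodSeries : denominatorPoly • (+ 72 ◂ goodSeries) ≈ₛ ⟦ numeratorPoly ⟧
  denominator-•-goodSeries = •-cancel cofactorTail {denominatorPoly • (+ 72 ◂ goodSeries)} {⟦ numeratorPoly ⟧}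
    (≈-trans (≈-sym (⊠-• cofactor denominatorPoly (+ 72 ◂ goodSeries)))
    (≈-trans (λ n → cong (λ p → (p • (+ 72 ◂ goodSeries)) n) common)
    (≈-trans (•-◂ commonDenominator (+ 72) goodSeries)
    (≈-trans (◂-cong (+ 72) (cleared cleared-goodSeries))
    (≈-trans (≈-sym (scale-• (+ 72) (numerator cleared-goodSeries) 1ₛ))
    (≈-trans (λ n → cong (λ p → ⟦ p ⟧ n) numerators)
    (⊠-• cofactor numeratorPoly 1ₛ)))))))
    where
    -- `cofactor` is (1 - x)^5 (1 - x^2), the surplus of the common denominator over the stated one.
    cofactorTail cofactor : Polyℤ
    cofactorTail = -[1+ 4 ] ∷ + 9 ∷ -[1+ 4 ] ∷ -[1+ 4 ] ∷ + 9 ∷ -[1+ 4 ] ∷ 1ℤ ∷ []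
    cofactor = 1ℤ ∷ cofactorTail
    common : cofactor ⊠ denominatorPoly ≡ commonDenominator
    common = toWitness {a? = cofactor ⊠ denominatorPoly ≟ₚ commonDenominator} _
    numerators : scale (+ 72) (numerator cleared-goodSeries) ≡ cofactor ⊠ numeratorPoly
    numerators = toWitness {a? = scale (+ 72) (numerator cleared-goodSeries) ≟ₚ cofactor ⊠ numeratorPoly} _

open ClosedForm

-- Reduction by the 72 symmetries to normal squares

module Symmetry where

  open import Data.Nat.Base using (_*_; _⊓_)
  open import Data.Vec.Base using (concat; sum)
  open import Data.Vec.Relation.Unary.All using (All)
  open import Relation.Binary.Definitions using (tri<; tri≈; tri>)
  open ℕ.+-*-Solver using (solve; _:+_; _:*_; _:=_; con)
  open IsSemimagic

  private variable
    n t : ℕ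

  pattern square a b c d e f g h i = (a ∷ b ∷ c ∷ []) ∷ (d ∷ e ∷ f ∷ []) ∷ (g ∷ h ∷ i ∷ []) ∷ []

  rotateRows rotateColumns swapRows swapColumns flip : Matrix → Matrix
  rotateRows    (square a b c d e f g h i) = square d e f g h i a b c
  rotateColumns (square a b c d e f g h i) = square b c a e f d h i g
  swapRows      (square a b c d e f g h i) = square a b c g h i d e f
  swapColumns   (square a b c d e f g h i) = square a c b d f e g i h
  flip          (square a b c d e f g h i) = square a d g b e h c f i

  -- Every symmetry permutes the nine positions, so positivity, distinctness and bounds carry over
  -- uniformly; the line sums alone need an argument for each symmetry.
  reindex-counted : ∀ {M M′} (π : Vec (Fin 9) 9) {_ : True (allPairs? (λ p q → ¬? (p Fin.≟ q)) π)} →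
                    concat M′ ≡ Vec.map (lookup (concat M)) π →
                    (EqualLineSums M → EqualLineSums M′) → IsCounted t M → IsCounted t M′
  reindex-counted {M = M} π {π!} eq lines (semimagic , bounds) =
    mkSemimagic
      (subst (All _) (sym eq) (reindex-All (positive semimagic)))
      (subst UniqueVec (sym eq)
        (UniqueVec.map⁺ (UniqueVec.lookup-injective (distinct semimagic) _ _) (toWitness π!)))
      (lines (lineSums semimagic))
    , subst (All _) (sym eq) (reindex-All bounds)
    where
    reindex-All : ∀ {P : ℕ → Set} → All P (concat M) → All P (Vec.map (lookup (concat M)) π)
    reindex-All all = VecAll.map⁺ (VecAll.universal (λ p → VecAll.lookup⁺ all p) π)

  sum-rotate : ∀ {s} a b c → sum (a ∷ b ∷ c ∷ []) ≡ s → sum (b ∷ c ∷ a ∷ []) ≡ s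
  sum-rotate a b c = trans (solve 3 (λ a b c →
    b :+ (c :+ (a :+ con 0)) := a :+ (b :+ (c :+ con 0))) refl a b c)

  sum-swap : ∀ {s} a b c → sum (a ∷ b ∷ c ∷ []) ≡ s → sum (a ∷ c ∷ b ∷ []) ≡ s
  sum-swap a b c = trans (solve 3 (λ a b c →
    a :+ (c :+ (b :+ con 0)) := a :+ (b :+ (c :+ con 0))) refl a b c)

  rotateRows-counted : ∀ {M} → IsCounted t M → IsCounted t (rotateRows M)
  rotateRows-counted {M = square a b c d e f g h i} =
    reindex-counted {M = square a b c d e f g h i} (3F ∷ 4F ∷ 5F ∷ 6F ∷ 7F ∷ 8F ∷ 0F ∷ 1F ∷ 2F ∷ []) refl
      λ { (s , (x ∷ y ∷ z ∷ []) , (u ∷ v ∷ w ∷ [])) →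
          s , (y ∷ z ∷ x ∷ []) , (sum-rotate a d g u ∷ sum-rotate b e h v ∷ sum-rotate c f i w ∷ []) }

  rotateColumns-counted : ∀ {M} → IsCounted t M → IsCounted t (rotateColumns M)
  rotateColumns-counted {M = square a b c d e f g h i} =
    reindex-counted {M = square a b c d e f g h i} (1F ∷ 2F ∷ 0F ∷ 4F ∷ 5F ∷ 3F ∷ 7F ∷ 8F ∷ 6F ∷ []) refl
      λ { (s , (x ∷ y ∷ z ∷ []) , (u ∷ v ∷ w ∷ [])) →
          s , (sum-rotate a b c x ∷ sum-rotate d e f y ∷ sum-rotate g h i z ∷ []) , (v ∷ w ∷ u ∷ []) }

  swapRows-counted : ∀ {M} → IsCounted t M → IsCounted t (swapRows M)
  swapRows-counted {M = square a b c d e f g h i} =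
    reindex-counted {M = square a b c d e f g h i} (0F ∷ 1F ∷ 2F ∷ 6F ∷ 7F ∷ 8F ∷ 3F ∷ 4F ∷ 5F ∷ []) refl
      λ { (s , (x ∷ y ∷ z ∷ []) , (u ∷ v ∷ w ∷ [])) →
          s , (x ∷ z ∷ y ∷ []) , (sum-swap a d g u ∷ sum-swap b e h v ∷ sum-swap c f i w ∷ []) }

  swapColumns-counted : ∀ {M} → IsCounted t M → IsCounted t (swapColumns M)
  swapColumns-counted {M = square a b c d e f g h i} =
    reindex-counted {M = square a b c d e f g h i} (0F ∷ 2F ∷ 1F ∷ 3F ∷ 5F ∷ 4F ∷ 6F ∷ 8F ∷ 7F ∷ []) refl
      λ { (s , (x ∷ y ∷ z ∷ []) , (u ∷ v ∷ w ∷ [])) →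
          s , (sum-swap a b c x ∷ sum-swap d e f y ∷ sum-swap g h i z ∷ []) , (u ∷ w ∷ v ∷ []) }

  flip-counted : ∀ {M} → IsCounted t M → IsCounted t (flip M)
  flip-counted {M = square a b c d e f g h i} =
    reindex-counted {M = square a b c d e f g h i} (0F ∷ 3F ∷ 6F ∷ 1F ∷ 4F ∷ 7F ∷ 2F ∷ 5F ∷ 8F ∷ []) refl
      λ { (s , rows , columns) → s , columns , rows }

  apart : ∀ M → IsCounted t M → ∀ p q {_ : False (p Fin.≟ q)} → lookup (concat M) p ≢ lookup (concat M) q
  apart M (semimagic , _) p q {p≢q} eq =
    toWitnessFalse p≢q (UniqueVec.lookup-injective (distinct semimagic) p q eq)

  minimum : Vec ℕ 3 → ℕ
  minimum (a ∷ b ∷ c ∷ []) = a ⊓ (b ⊓ c)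

  LeastFirst : ℕ → ℕ → ℕ → Set
  LeastFirst a b c = a < b × a < c

  leastFirst-cyclic : ∀ {a b c} → a ≢ b → a ≢ c → b ≢ c →
                      LeastFirst a b c ⊎ LeastFirst b c a ⊎ LeastFirst c a b
  leastFirst-cyclic {a} {b} {c} a≢b a≢c b≢c with ℕ.<-cmp a b | ℕ.<-cmp a c | ℕ.<-cmp b c
  ... | tri≈ _ a≡b _ | _            | _            = ⊥-elim (a≢b a≡b)
  ... | _            | tri≈ _ a≡c _ | _            = ⊥-elim (a≢c a≡c)
  ... | _            | _            | tri≈ _ b≡c _ = ⊥-elim (b≢c b≡c)
  ... | tri< a<b _ _ | tri< a<c _ _ | _            = inj₁ (a<b , a<c)
  ... | tri> _ _ b<a | _            | tri< b<c _ _ = inj₂ (inj₁ (b<c , b<a))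
  ... | _            | tri> _ _ c<a | tri> _ _ c<b = inj₂ (inj₂ (c<a , c<b))
  ... | tri< a<b _ _ | tri> _ _ c<a | tri< b<c _ _ = ⊥-elim (ℕ.<-asym (ℕ.<-trans a<b b<c) c<a)
  ... | tri> _ _ b<a | tri< a<c _ _ | tri> _ _ c<b = ⊥-elim (ℕ.<-asym (ℕ.<-trans b<a a<c) c<b)

  minimum-attained : ∀ r → ∃[ j ] minimum r ≡ lookup r j
  minimum-attained (a ∷ b ∷ c ∷ []) with ℕ.⊓-sel a (b ⊓ c) | ℕ.⊓-sel b c
  ... | inj₁ eq | _       = 0F , eq
  ... | inj₂ eq | inj₁ eq′ = 1F , trans eq eq′
  ... | inj₂ eq | inj₂ eq′ = 2F , trans eq eq′

  minimum-≤ : ∀ r j → minimum r ≤ lookup r j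
  minimum-≤ (a ∷ b ∷ c ∷ []) 0F = ℕ.m⊓n≤m a (b ⊓ c)
  minimum-≤ (a ∷ b ∷ c ∷ []) 1F = ℕ.≤-trans (ℕ.m⊓n≤n a (b ⊓ c)) (ℕ.m⊓n≤m b c)
  minimum-≤ (a ∷ b ∷ c ∷ []) 2F = ℕ.≤-trans (ℕ.m⊓n≤n a (b ⊓ c)) (ℕ.m⊓n≤n b c)

  minimum-< : ∀ {x} r → (∀ j → x < lookup r j) → x < minimum r
  minimum-< r x< = let j , eq = minimum-attained r in subst (_ <_) (sym eq) (x< j)

  -- `FirstRow` speaks of row minima, so that it survives rotations of the columns. The smallest
  -- entry can thus be brought to the top row first and to the left column afterwards.
  FirstRow Corner RowsSorted ColumnsSorted UpperSmaller : Matrix → Set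
  FirstRow (r ∷ r′ ∷ r″ ∷ []) = LeastFirst (minimum r) (minimum r′) (minimum r″)
  Corner (square a b c d e f g h i) =
    (a < b × a < c) × (a < d × a < g) × (a < e × a < f × a < h × a < i)
  ColumnsSorted (square a b c d e f g h i) = b < c
  RowsSorted (square a b c d e f g h i) = d < g
  UpperSmaller (square a b c d e f g h i) = b < d

  InFirstRow InCorner InCornerₓ InCornerₓₓ Normal : ℕ → Matrix → Set
  InFirstRow t M = IsCounted t M × FirstRow M
  InCorner   t M = IsCounted t M × Corner M
  InCornerₓ  t M = InCorner t M × ColumnsSorted M
  InCornerₓₓ t M = InCornerₓ t M × RowsSorted M
  Normal     t M = InCornerₓₓ t M × UpperSmaller M

  minimum-rotate : ∀ a b c → minimum (a ∷ b ∷ c ∷ []) ≡ minimum (b ∷ c ∷ a ∷ [])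
  minimum-rotate a b c = trans (ℕ.⊓-comm a (b ⊓ c)) (ℕ.⊓-assoc b c a)

  firstRow-rotateColumns : ∀ {M} → FirstRow M → FirstRow (rotateColumns M)
  firstRow-rotateColumns {square a b c d e f g h i}
    rewrite minimum-rotate a b c | minimum-rotate d e f | minimum-rotate g h i = id

  corner⇒firstRow : ∀ {M} → Corner M → FirstRow M
  corner⇒firstRow {square a b c d e f g h i} (_ , (a<d , a<g) , a<e , a<f , a<h , a<i) =
    below (λ { 0F → a<d ; 1F → a<e ; 2F → a<f }) , below (λ { 0F → a<g ; 1F → a<h ; 2F → a<i })
    where
    below : ∀ {r} → (∀ j → a < lookup r j) → minimum (a ∷ b ∷ c ∷ []) < minimum r
    below {r} a< = ℕ.≤-<-trans (minimum-≤ (a ∷ b ∷ c ∷ []) 0F) (minimum-< r a<)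

  firstRow⇒corner : ∀ {a b c d e f g h i} → FirstRow (square a b c d e f g h i) →
                    LeastFirst a b c → Corner (square a b c d e f g h i)
  firstRow⇒corner {a} {b} {c} {d} {e} {f} {g} {h} {i} (m<m′ , m<m″) (a<b , a<c) =
    (a<b , a<c) , (below₁ 0F , below₂ 0F) , below₁ 1F , below₁ 2F , below₂ 1F , below₂ 2F
    where
    a≤m : a ≤ minimum (a ∷ b ∷ c ∷ [])
    a≤m = ℕ.⊓-glb ℕ.≤-refl (ℕ.⊓-glb (ℕ.<⇒≤ a<b) (ℕ.<⇒≤ a<c))
    below₁ : ∀ j → a < lookup (d ∷ e ∷ f ∷ []) j
    below₁ j = ℕ.≤-<-trans a≤m (ℕ.<-≤-trans m<m′ (minimum-≤ (d ∷ e ∷ f ∷ []) j))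
    below₂ : ∀ j → a < lookup (g ∷ h ∷ i ∷ []) j
    below₂ j = ℕ.≤-<-trans a≤m (ℕ.<-≤-trans m<m″ (minimum-≤ (g ∷ h ∷ i ∷ []) j))

  <-or-> : ∀ {m n} → m ≢ n → m < n ⊎ n < m
  <-or-> {m} {n} m≢n with ℕ.<-cmp m n
  ... | tri< m<n _ _ = inj₁ m<n
  ... | tri≈ _ m≡n _ = ⊥-elim (m≢n m≡n)
  ... | tri> _ _ n<m = inj₂ n<m

  -- 72 = 3 · 3 · 2 · 2 · 2, one factor for each normalisation. The order is such that every
  -- symmetry preserves what has been normalised before it; transposition comes last, as it
  -- exchanges the two sortedness conditions and leaves their conjunction intact.
  counted-size : Normal t HasSize n → IsCounted t HasSize (72 * n)
  counted-size {t} {n} normal = subst (IsCounted t HasSize_)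
    (solve 1 (λ n → con 3 :* (con 3 :* (con 2 :* (con 2 :* (con 2 :* n)))) := con 72 :* n) refl n)
    (rows₃ (columns₃ (columns₂ (rows₂ (flips normal)))))
    where
    rows₃ : ∀ {n} → InFirstRow t HasSize n → IsCounted t HasSize (3 * n)
    rows₃ = size-×3 rotateRows (λ { {square _ _ _ _ _ _ _ _ _} _ → refl }) rotateRows-counted proj₁
      (λ {M} p → Sum.map (p ,_) (Sum.map (rotateRows-counted p ,_) (rotateRows-counted (rotateRows-counted p) ,_)) (cover M p))
      (λ { {square _ _ _ _ _ _ _ _ _} (_ , m<m′ , _) (_ , _ , m′<m) → ℕ.<-asym m<m′ m′<m })
      (λ { {square _ _ _ _ _ _ _ _ _} (_ , _ , m<m″) (_ , m″<m , _) → ℕ.<-asym m<m″ m″<m })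
      where
      -- Each minimum is an entry of its row, and entries in different rows differ.
      minima-apart : ∀ M → IsCounted t M → ∀ i i′ → i ≢ i′ → minimum (lookup M i) ≢ minimum (lookup M i′)
      minima-apart M (semimagic , _) i i′ i≢i′ eq =
        let j  , at  = minimum-attained (lookup M i)
            j′ , at′ = minimum-attained (lookup M i′)
        in i≢i′ (proj₁ (Fin.combine-injective i j i′ j′
             (UniqueVec.lookup-injective (distinct semimagic) _ _
               (trans (Vec.lookup-concat M i j) (trans (sym at) (trans eq (trans at′ (sym (Vec.lookup-concat M i′ j′)))))))))
      cover : ∀ M → IsCounted t M → FirstRow M ⊎ FirstRow (rotateRows M) ⊎ FirstRow (rotateRows (rotateRows M))
      cover M@(square _ _ _ _ _ _ _ _ _) p = leastFirst-cyclic
        (minima-apart M p 0F 1F λ ()) (minima-apart M p 0F 2F λ ()) (minima-apart M p 1F 2F λ ())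

    columns₃ : ∀ {n} → InCorner t HasSize n → InFirstRow t HasSize (3 * n)
    columns₃ = size-×3 rotateColumns (λ { {square _ _ _ _ _ _ _ _ _} _ → refl }) closed
      (λ {M} (p , q) → p , corner⇒firstRow {M} q) (λ {M} → cover M)
      (λ { {square _ _ _ _ _ _ _ _ _} (_ , (a<b , _) , _) (_ , (_ , b<a) , _) → ℕ.<-asym a<b b<a })
      (λ { {square _ _ _ _ _ _ _ _ _} (_ , (_ , a<c) , _) (_ , (c<a , _) , _) → ℕ.<-asym a<c c<a })
      where
      closed : ∀ {M} → InFirstRow t M → InFirstRow t (rotateColumns M)
      closed {M} (p , q) = rotateColumns-counted p , firstRow-rotateColumns {M} q
      cover : ∀ M → InFirstRow t M →
              InCorner t M ⊎ InCorner t (rotateColumns M) ⊎ InCorner t (rotateColumns (rotateColumns M))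
      cover M@(square _ _ _ _ _ _ _ _ _) p = Sum.map (inCorner p)
        (Sum.map (inCorner (closed p)) (inCorner (closed (closed p))))
        (leastFirst-cyclic (apart M (proj₁ p) 0F 1F) (apart M (proj₁ p) 0F 2F) (apart M (proj₁ p) 1F 2F))
        where
        inCorner : ∀ {a b c d e f g h i} → InFirstRow t (square a b c d e f g h i) →
                   LeastFirst a b c → InCorner t (square a b c d e f g h i)
        inCorner (p , q) least = p , firstRow⇒corner q least

    columns₂ : ∀ {n} → InCornerₓ t HasSize n → InCorner t HasSize (2 * n)
    columns₂ = size-×2 swapColumns (λ { {square _ _ _ _ _ _ _ _ _} _ → refl }) closed proj₁
      (λ {M} → cover M)
      (λ { {square _ _ _ _ _ _ _ _ _} (_ , b<c) (_ , c<b) → ℕ.<-asym b<c c<b })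
      where
      closed : ∀ {M} → InCorner t M → InCorner t (swapColumns M)
      closed {square _ _ _ _ _ _ _ _ _} (p , (b , c) , (d , g) , e , f , h , i) =
        swapColumns-counted p , (c , b) , (d , g) , f , e , i , h
      cover : ∀ M → InCorner t M → InCornerₓ t M ⊎ InCornerₓ t (swapColumns M)
      cover M@(square _ _ _ _ _ _ _ _ _) p =
        Sum.map (p ,_) (closed p ,_) (<-or-> (apart M (proj₁ p) 1F 2F))

    rows₂ : ∀ {n} → InCornerₓₓ t HasSize n → InCornerₓ t HasSize (2 * n)
    rows₂ = size-×2 swapRows (λ { {square _ _ _ _ _ _ _ _ _} _ → refl }) closed proj₁
      (λ {M} → cover M)
      (λ { {square _ _ _ _ _ _ _ _ _} (_ , d<g) (_ , g<d) → ℕ.<-asym d<g g<d })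
      where
      closed : ∀ {M} → InCornerₓ t M → InCornerₓ t (swapRows M)
      closed {square _ _ _ _ _ _ _ _ _} ((p , (b , c) , (d , g) , e , f , h , i) , b<c) =
        (swapRows-counted p , (b , c) , (g , d) , h , i , e , f) , b<c
      cover : ∀ M → InCornerₓ t M → InCornerₓₓ t M ⊎ InCornerₓₓ t (swapRows M)
      cover M@(square _ _ _ _ _ _ _ _ _) p =
        Sum.map (p ,_) (closed p ,_) (<-or-> (apart M (proj₁ (proj₁ p)) 3F 6F))

    flips : ∀ {n} → Normal t HasSize n → InCornerₓₓ t HasSize (2 * n)
    flips = size-×2 flip (λ { {square _ _ _ _ _ _ _ _ _} _ → refl }) closed proj₁
      (λ {M} → cover M)
      (λ { {square _ _ _ _ _ _ _ _ _} (_ , b<d) (_ , d<b) → ℕ.<-asym b<d d<b })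
      where
      closed : ∀ {M} → InCornerₓₓ t M → InCornerₓₓ t (flip M)
      closed {square _ _ _ _ _ _ _ _ _} (((p , (b , c) , (d , g) , e , f , h , i) , b<c) , d<g) =
        ((flip-counted p , (d , g) , (b , c) , e , h , f , i) , d<g) , b<c
      cover : ∀ M → InCornerₓₓ t M → Normal t M ⊎ Normal t (flip M)
      cover M@(square _ _ _ _ _ _ _ _ _) p =
        Sum.map (p ,_) (closed p ,_) (<-or-> (apart M (proj₁ (proj₁ (proj₁ p))) 1F 3F))

open Symmetry

-- The bijection between normal squares and orthant points

module Reconstruction where

  open import Data.Nat.Base using (_+_; _*_; _∸_)
  open import Data.Vec.Base using (concat; sum; transpose)
  open import Data.Vec.Relation.Unary.All using (All)
  open import Data.Vec.Relation.Binary.Pointwise.Inductive as Pointwise using (Pointwise; []; _∷_)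
  open Equivalence using (to; from)
  open ℕ.+-*-Solver using (Polynomial; solve; _:+_; _:*_; _:=_; con)
  open IsSemimagic

  private variable
    k n t : ℕ

  -- The coordinates nᵢ stand for the positive integers suc nᵢ, whence the constant term.

  form : Vec ℕ k → Vec ℕ k → ℕ
  form ws = linear (sum ws) ws

  form-≥ : ∀ c (ws v : Vec ℕ k) → c ≤ linear c ws v
  form-≥ c []       []      = ℕ.≤-refl
  form-≥ c (w ∷ ws) (n ∷ v) = ℕ.≤-trans (form-≥ c ws v) (ℕ.m≤n+m _ (n * w))

  linear-mono : ∀ {c c′} {ws ws′ : Vec ℕ k} → c ≤ c′ → Pointwise _≤_ ws ws′ →
                ∀ v → linear c ws v ≤ linear c′ ws′ v
  linear-mono c≤ []       []      = c≤
  linear-mono c≤ (w≤ ∷ ws≤) (n ∷ v) = ℕ.+-mono-≤ (ℕ.*-monoʳ-≤ n w≤) (linear-mono c≤ ws≤ v)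

  linear-suc : ∀ c (ws v : Vec ℕ k) → linear (suc c) ws v ≡ suc (linear c ws v)
  linear-suc c []       []      = refl
  linear-suc c (w ∷ ws) (n ∷ v) = trans (cong (_+_ (n * w)) (linear-suc c ws v)) (ℕ.+-suc (n * w) _)

  -- The nine entries, row by row, as linear forms in A, F, I, J, K.
  coefficient : Fin 9 → Vec ℕ 5
  coefficient = lookup (
    (1 ∷ 0 ∷ 0 ∷ 0 ∷ 0 ∷ []) ∷ (1 ∷ 1 ∷ 1 ∷ 0 ∷ 0 ∷ []) ∷ (1 ∷ 1 ∷ 1 ∷ 2 ∷ 1 ∷ []) ∷
    (1 ∷ 1 ∷ 1 ∷ 1 ∷ 0 ∷ []) ∷ (1 ∷ 1 ∷ 0 ∷ 1 ∷ 1 ∷ []) ∷ (1 ∷ 0 ∷ 1 ∷ 0 ∷ 0 ∷ []) ∷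
    (1 ∷ 1 ∷ 1 ∷ 1 ∷ 1 ∷ []) ∷ (1 ∷ 0 ∷ 1 ∷ 1 ∷ 0 ∷ []) ∷ (1 ∷ 1 ∷ 0 ∷ 0 ∷ 0 ∷ []) ∷ [])

  entry : Fin 9 → Vec ℕ 5 → ℕ
  entry p = form (coefficient p)

  normalSquare : Vec ℕ 6 → Matrix
  normalSquare (_ ∷ v) = square (entry 0F v) (entry 1F v) (entry 2F v) (entry 3F v) (entry 4F v)
                                (entry 5F v) (entry 6F v) (entry 7F v) (entry 8F v)

  _≤ᶠ?_ : ∀ p q → Dec (Pointwise _≤_ (coefficient p) (coefficient q))
  p ≤ᶠ? q = Pointwise.decidable ℕ._≤?_ (coefficient p) (coefficient q)

  entry-≤ : ∀ p q {_ : True (p ≤ᶠ? q)} {_ : True (sum (coefficient p) ℕ.≤? sum (coefficient q))} →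
            ∀ v → entry p v ≤ entry q v
  entry-≤ p q {ws≤} {c≤} = linear-mono (toWitness c≤) (toWitness ws≤)

  -- The sum of the coefficients is the constant term in the shifted variables; if it grows while no
  -- coefficient drops, the form grows strictly.
  entry-< : ∀ p q {_ : True (p ≤ᶠ? q)} {_ : True (sum (coefficient p) ℕ.<? sum (coefficient q))} →
            ∀ v → entry p v < entry q v
  entry-< p q {ws≤} {c<} v = subst (_≤ entry q v) (linear-suc (sum (coefficient p)) (coefficient p) v)
                               (linear-mono (toWitness c<) (toWitness ws≤) v)

  entryᵖ : Fin 9 → (a f i j k : Polynomial n) → Polynomial n
  entryᵖ p a f i j k = linearᵖ (sum (coefficient p)) (coefficient p) (a ∷ f ∷ i ∷ j ∷ k ∷ [])

  cancel-common : ∀ c {m n x y} → x ≡ c + m → y ≡ c + n → (x ≡ y) ⇔ (m ≡ n)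
  cancel-common c x≡ y≡ = mk⇔
    (λ x≡y → ℕ.+-cancelˡ-≡ c _ _ (trans (sym x≡) (trans x≡y y≡)))
    (λ m≡n → trans x≡ (trans (cong (c ℕ.+_) m≡n) (sym y≡)))

  weight-corner : ∀ l v → weight (l ∷ v) ≡ suc l + entry 2F v
  weight-corner l (a ∷ f ∷ i ∷ j ∷ k ∷ []) =
    solve 6 (λ l a f i j k → weightᵖ l a f i j k := (con 1 :+ l) :+ entryᵖ 2F a f i j k) refl l a f i j k

  module Entries (a f i j k : ℕ) where
    private
      v : Vec ℕ 5
      v = a ∷ f ∷ i ∷ j ∷ k ∷ []

    gap-0 : suc a ≡ entry 0F v
    gap-0 = solve 5 (λ a f i j k → con 1 :+ a := entryᵖ 0F a f i j k) refl a f i j k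

    gap-8 : suc (entry 0F v) + f ≡ entry 8F v
    gap-8 = solve 5 (λ a f i j k → (con 1 :+ entryᵖ 0F a f i j k) :+ f := entryᵖ 8F a f i j k) refl a f i j k

    gap-5 : suc (entry 0F v) + i ≡ entry 5F v
    gap-5 = solve 5 (λ a f i j k → (con 1 :+ entryᵖ 0F a f i j k) :+ i := entryᵖ 5F a f i j k) refl a f i j k

    gap-3 : suc (entry 1F v) + j ≡ entry 3F v
    gap-3 = solve 5 (λ a f i j k → (con 1 :+ entryᵖ 1F a f i j k) :+ j := entryᵖ 3F a f i j k) refl a f i j k

    gap-6 : suc (entry 3F v) + k ≡ entry 6F v
    gap-6 = solve 5 (λ a f i j k → (con 1 :+ entryᵖ 3F a f i j k) :+ k := entryᵖ 6F a f i j k) refl a f i j k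

    is-entry-0 : ∀ {x} → suc a ≡ x → x ≡ entry 0F v
    is-entry-0 eq = trans (sym eq) gap-0

    is-entry-8 : ∀ {x} → suc (entry 0F v) + f ≡ x → x ≡ entry 8F v
    is-entry-8 eq = trans (sym eq) gap-8

    is-entry-5 : ∀ {x} → suc (entry 0F v) + i ≡ x → x ≡ entry 5F v
    is-entry-5 eq = trans (sym eq) gap-5

    is-entry-3 : ∀ {x} → suc (entry 1F v) + j ≡ x → x ≡ entry 3F v
    is-entry-3 eq = trans (sym eq) gap-3

    is-entry-6 : ∀ {x} → suc (entry 3F v) + k ≡ x → x ≡ entry 6F v
    is-entry-6 eq = trans (sym eq) gap-6

    -- The only coincidences between entries that the order relations leave open.

    entry-1-4 : (entry 1F v ≡ entry 4F v) ⇔ (i ≡ j + suc k)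
    entry-1-4 = cancel-common (3 + a + f)
      (solve 5 (λ a f i j k → entryᵖ 1F a f i j k := con 3 :+ a :+ f :+ i) refl a f i j k)
      (solve 5 (λ a f i j k → entryᵖ 4F a f i j k := con 3 :+ a :+ f :+ (j :+ (con 1 :+ k))) refl a f i j k)

    entry-3-4 : (entry 3F v ≡ entry 4F v) ⇔ (i ≡ k)
    entry-3-4 = cancel-common (4 + a + f + j)
      (solve 5 (λ a f i j k → entryᵖ 3F a f i j k := con 4 :+ a :+ f :+ j :+ i) refl a f i j k)
      (solve 5 (λ a f i j k → entryᵖ 4F a f i j k := con 4 :+ a :+ f :+ j :+ k) refl a f i j k)

    entry-4-5 : (entry 4F v ≡ entry 5F v) ⇔ (f + suc j + suc k ≡ i)
    entry-4-5 = cancel-common (2 + a)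
      (solve 5 (λ a f i j k → entryᵖ 4F a f i j k := con 2 :+ a :+ (f :+ (con 1 :+ j) :+ (con 1 :+ k))) refl a f i j k)
      (solve 5 (λ a f i j k → entryᵖ 5F a f i j k := con 2 :+ a :+ i) refl a f i j k)

    entry-4-7 : (entry 4F v ≡ entry 7F v) ⇔ (f + suc k ≡ i)
    entry-4-7 = cancel-common (3 + a + j)
      (solve 5 (λ a f i j k → entryᵖ 4F a f i j k := con 3 :+ a :+ j :+ (f :+ (con 1 :+ k))) refl a f i j k)
      (solve 5 (λ a f i j k → entryᵖ 7F a f i j k := con 3 :+ a :+ j :+ i) refl a f i j k)

    entry-1-7 : (entry 1F v ≡ entry 7F v) ⇔ (f ≡ j)
    entry-1-7 = cancel-common (3 + a + i)
      (solve 5 (λ a f i j k → entryᵖ 1F a f i j k := con 3 :+ a :+ i :+ f) refl a f i j k)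
      (solve 5 (λ a f i j k → entryᵖ 7F a f i j k := con 3 :+ a :+ i :+ j) refl a f i j k)

    entry-5-8 : (entry 5F v ≡ entry 8F v) ⇔ (i ≡ f)
    entry-5-8 = cancel-common (2 + a)
      (solve 5 (λ a f i j k → entryᵖ 5F a f i j k := con 2 :+ a :+ i) refl a f i j k)
      (solve 5 (λ a f i j k → entryᵖ 8F a f i j k := con 2 :+ a :+ f) refl a f i j k)

    entry-7-8 : (entry 7F v ≡ entry 8F v) ⇔ (i + suc j ≡ f)
    entry-7-8 = cancel-common (2 + a)
      (solve 5 (λ a f i j k → entryᵖ 7F a f i j k := con 2 :+ a :+ (i :+ (con 1 :+ j))) refl a f i j k)
      (solve 5 (λ a f i j k → entryᵖ 8F a f i j k := con 2 :+ a :+ f) refl a f i j k)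

    -- The first row and the last column share the corner `y`, still unknown at this point, which
    -- cancels when the two are equated.
    is-entry-1 : ∀ {s} x y → entry 0F v + (x + (y + 0)) ≡ s → y + (entry 5F v + (entry 8F v + 0)) ≡ s → x ≡ entry 1F v
    is-entry-1 x y row column = to (cancel-common (entry 0F v + y)
      {m = x} {entry 1F v} {entry 0F v + (x + (y + 0))} {y + (entry 5F v + (entry 8F v + 0))}
      (solve 7 (λ a f i j k x y → entryᵖ 0F a f i j k :+ (x :+ (y :+ con 0))
        := (entryᵖ 0F a f i j k :+ y) :+ x) refl a f i j k x y)
      (solve 7 (λ a f i j k x y → y :+ (entryᵖ 5F a f i j k :+ (entryᵖ 8F a f i j k :+ con 0))
        := (entryᵖ 0F a f i j k :+ y) :+ entryᵖ 1F a f i j k) refl a f i j k x y)) (trans row (sym column))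

    is-entry-7 : ∀ {s} x → entry 6F v + (x + (entry 8F v + 0)) ≡ s → entry 0F v + (entry 3F v + (entry 6F v + 0)) ≡ s → x ≡ entry 7F v
    is-entry-7 x row column = to (cancel-common (entry 6F v + entry 8F v)
      {m = x} {entry 7F v} {entry 6F v + (x + (entry 8F v + 0))} {entry 0F v + (entry 3F v + (entry 6F v + 0))}
      (solve 6 (λ a f i j k x → entryᵖ 6F a f i j k :+ (x :+ (entryᵖ 8F a f i j k :+ con 0))
        := (entryᵖ 6F a f i j k :+ entryᵖ 8F a f i j k) :+ x) refl a f i j k x)
      (solve 6 (λ a f i j k x → entryᵖ 0F a f i j k :+ (entryᵖ 3F a f i j k :+ (entryᵖ 6F a f i j k :+ con 0))
        := (entryᵖ 6F a f i j k :+ entryᵖ 8F a f i j k) :+ entryᵖ 7F a f i j k) refl a f i j k x)) (trans row (sym column))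

    is-entry-4 : ∀ {s} x → entry 3F v + (x + (entry 5F v + 0)) ≡ s → entry 0F v + (entry 3F v + (entry 6F v + 0)) ≡ s → x ≡ entry 4F v
    is-entry-4 x row column = to (cancel-common (entry 3F v + entry 5F v)
      {m = x} {entry 4F v} {entry 3F v + (x + (entry 5F v + 0))} {entry 0F v + (entry 3F v + (entry 6F v + 0))}
      (solve 6 (λ a f i j k x → entryᵖ 3F a f i j k :+ (x :+ (entryᵖ 5F a f i j k :+ con 0))
        := (entryᵖ 3F a f i j k :+ entryᵖ 5F a f i j k) :+ x) refl a f i j k x)
      (solve 6 (λ a f i j k x → entryᵖ 0F a f i j k :+ (entryᵖ 3F a f i j k :+ (entryᵖ 6F a f i j k :+ con 0))
        := (entryᵖ 3F a f i j k :+ entryᵖ 5F a f i j k) :+ entryᵖ 4F a f i j k) refl a f i j k x)) (trans row (sym column))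

    is-entry-2 : ∀ {s} x → entry 0F v + (entry 1F v + (x + 0)) ≡ s → entry 0F v + (entry 3F v + (entry 6F v + 0)) ≡ s → x ≡ entry 2F v
    is-entry-2 x row column = to (cancel-common (entry 0F v + entry 1F v)
      {m = x} {entry 2F v} {entry 0F v + (entry 1F v + (x + 0))} {entry 0F v + (entry 3F v + (entry 6F v + 0))}
      (solve 6 (λ a f i j k x → entryᵖ 0F a f i j k :+ (entryᵖ 1F a f i j k :+ (x :+ con 0))
        := (entryᵖ 0F a f i j k :+ entryᵖ 1F a f i j k) :+ x) refl a f i j k x)
      (solve 6 (λ a f i j k x → entryᵖ 0F a f i j k :+ (entryᵖ 3F a f i j k :+ (entryᵖ 6F a f i j k :+ con 0))
        := (entryᵖ 0F a f i j k :+ entryᵖ 1F a f i j k) :+ entryᵖ 2F a f i j k) refl a f i j k x)) (trans row (sym column))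

    -- Matrices with equal line sums form a five-parameter family, so five gaps determine the
    -- square. The order of the steps matters: the second entry of the first row must come from the
    -- line sums before the gaps leading to the first column can be used.
    reconstruct : ∀ {m₀ m₁ m₂ m₃ m₄ m₅ m₆ m₇ m₈ s} l →
      suc a ≡ m₀ → suc m₀ + f ≡ m₈ → suc m₀ + i ≡ m₅ → suc m₁ + j ≡ m₃ → suc m₃ + k ≡ m₆ →
      (let M = square m₀ m₁ m₂ m₃ m₄ m₅ m₆ m₇ m₈) →
      All (λ r → sum r ≡ s) M × All (λ c → sum c ≡ s) (transpose M) →
      normalSquare (l ∷ v) ≡ square m₀ m₁ m₂ m₃ m₄ m₅ m₆ m₇ m₈
    reconstruct {m₁ = m₁} {m₂} {m₄ = m₄} {m₇ = m₇} l m₀≡ m₈≡ m₅≡ m₃≡ m₆≡ ((row₀ ∷ row₁ ∷ row₂ ∷ []) , (column₀ ∷ _ ∷ column₂ ∷ []))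
      with refl ← is-entry-0 m₀≡
      with refl ← is-entry-8 m₈≡
      with refl ← is-entry-5 m₅≡
      with refl ← is-entry-1 m₁ m₂ row₀ column₂
      with refl ← is-entry-3 m₃≡
      with refl ← is-entry-6 m₆≡
      with refl ← is-entry-7 m₇ row₂ column₀
      with refl ← is-entry-4 m₄ row₁ column₀
      with refl ← is-entry-2 m₂ row₀ column₀
      = refl

  linear-+ : ∀ c c′ (ws ws′ v : Vec ℕ k) →
             linear c ws v + linear c′ ws′ v ≡ linear (c + c′) (Vec.zipWith _+_ ws ws′) v
  linear-+ c c′ []       []         []      = refl
  linear-+ c c′ (w ∷ ws) (w′ ∷ ws′) (n ∷ v) = trans
    (solve 5 (λ n w w′ x y → (n :* w :+ x) :+ (n :* w′ :+ y) := n :* (w :+ w′) :+ (x :+ y)) refl n w w′ _ _)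
    (cong (_+_ (n * (w + w′))) (linear-+ c c′ ws ws′ v))

  -- The common line sum 3A + 2F + 2I + 2J + K of a normal square.
  lineSum : Vec ℕ 5
  lineSum = 3 ∷ 2 ∷ 2 ∷ 2 ∷ 1 ∷ []

  line : ∀ p q r → Vec.zipWith _+_ (coefficient p) (Vec.zipWith _+_ (coefficient q) (coefficient r)) ≡ lineSum →
         sum (coefficient p) + (sum (coefficient q) + sum (coefficient r)) ≡ sum lineSum →
         ∀ v → sum (entry p v ∷ entry q v ∷ entry r v ∷ []) ≡ form lineSum v
  line p q r ws≡ c≡ v = begin
    entry p v + (entry q v + (entry r v + 0))
      ≡⟨ cong (λ x → entry p v + (entry q v + x)) (ℕ.+-identityʳ _) ⟩
    entry p v + (entry q v + entry r v)
      ≡⟨ cong (entry p v ℕ.+_) (linear-+ (sum (coefficient q)) (sum (coefficient r)) (coefficient q) (coefficient r) v) ⟩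
    entry p v + linear _ (Vec.zipWith _+_ (coefficient q) (coefficient r)) v
      ≡⟨ linear-+ (sum (coefficient p)) _ (coefficient p) _ v ⟩
    linear _ (Vec.zipWith _+_ (coefficient p) (Vec.zipWith _+_ (coefficient q) (coefficient r))) v
      ≡⟨ cong₂ (λ c ws → linear c ws v) c≡ ws≡ ⟩
    form lineSum v ∎
    where open ≡-Reasoning

  good⇒normal : ∀ {x} → Good t x → Normal t (normalSquare x)
  good⇒normal {t} {l ∷ v@(a ∷ f ∷ i ∷ j ∷ k ∷ [])}
    (((((((size , i≢k) , i≢j+k) , f≢i) , f≢j) , f≢i+j) , i≢f+k) , i≢f+j+k) =
    ((((mkSemimagic
          (VecAll.map proj₁ bounds)
          unique
          (form lineSum v
          , (line 0F 1F 2F refl refl v ∷ line 3F 4F 5F refl refl v ∷ line 6F 7F 8F refl refl v ∷ [])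
          , (line 0F 3F 6F refl refl v ∷ line 1F 4F 7F refl refl v ∷ line 2F 5F 8F refl refl v ∷ []))
       , bounds)
      , (entry-< 0F 1F v , entry-< 0F 2F v) , (entry-< 0F 3F v , entry-< 0F 6F v)
        , entry-< 0F 4F v , entry-< 0F 5F v , entry-< 0F 7F v , entry-< 0F 8F v)
     , entry-< 1F 2F v) , entry-< 3F 6F v) , entry-< 1F 3F v
    where
    open Entries a f i j k

    bound : ∀ p {_ : True (p ≤ᶠ? 2F)} {_ : True (sum (coefficient p) ℕ.≤? sum (coefficient 2F))}
            {_ : True (1 ℕ.≤? sum (coefficient p))} → 0 < entry p v × entry p v < t
    bound p {ws≤} {c≤} {c>0} =
      ℕ.≤-trans (toWitness c>0) (form-≥ (sum (coefficient p)) (coefficient p) v) ,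
      -- The last entry of the first row dominates all others coefficientwise, and the weight
      -- exceeds it by the slack `suc l`.
      subst (entry p v <_) (trans (sym (weight-corner l v)) size)
        (ℕ.≤-<-trans (entry-≤ p 2F {ws≤} {c≤} v) (ℕ.m<n+m (entry 2F v) {suc l} ℕ.z<s))

    bounds : All (λ x → 0 < x × x < t) (concat (normalSquare (l ∷ v)))
    bounds = bound 0F ∷ bound 1F ∷ bound 2F ∷ bound 3F ∷ bound 4F ∷ bound 5F ∷ bound 6F ∷ bound 7F ∷ bound 8F ∷ []

    lt : ∀ p q {_ : True (p ≤ᶠ? q)} {_ : True (sum (coefficient p) ℕ.<? sum (coefficient q))} →
         entry p v ≢ entry q v
    lt p q {ws≤} {c<} = ℕ.<⇒≢ (entry-< p q {ws≤} {c<} v)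

    gt : ∀ p q {_ : True (q ≤ᶠ? p)} {_ : True (sum (coefficient q) ℕ.<? sum (coefficient p))} →
         entry p v ≢ entry q v
    gt p q {ws≤} {c<} = ℕ.>⇒≢ (entry-< q p {ws≤} {c<} v)

    unique : UniqueVec (concat (normalSquare (l ∷ v)))
    unique =
      (lt 0F 1F ∷ lt 0F 2F ∷ lt 0F 3F ∷ lt 0F 4F ∷ lt 0F 5F ∷ lt 0F 6F ∷ lt 0F 7F ∷ lt 0F 8F ∷ []) ∷
      (lt 1F 2F ∷ lt 1F 3F ∷ i≢j+k ∘ to entry-1-4 ∷ gt 1F 5F ∷ lt 1F 6F ∷ f≢j ∘ to entry-1-7 ∷ gt 1F 8F ∷ []) ∷
      (gt 2F 3F ∷ gt 2F 4F ∷ gt 2F 5F ∷ gt 2F 6F ∷ gt 2F 7F ∷ gt 2F 8F ∷ []) ∷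
      (i≢k ∘ to entry-3-4 ∷ gt 3F 5F ∷ lt 3F 6F ∷ gt 3F 7F ∷ gt 3F 8F ∷ []) ∷
      (≢-sym i≢f+j+k ∘ to entry-4-5 ∷ lt 4F 6F ∷ ≢-sym i≢f+k ∘ to entry-4-7 ∷ gt 4F 8F ∷ []) ∷
      (lt 5F 6F ∷ lt 5F 7F ∷ ≢-sym f≢i ∘ to entry-5-8 ∷ []) ∷
      (gt 6F 7F ∷ gt 6F 8F ∷ []) ∷
      (≢-sym f≢i+j ∘ to entry-7-8 ∷ []) ∷
      [] ∷ []

  normal⇒good : ∀ M → Normal t M → ∃[ x ] Good t x × normalSquare x ≡ M
  normal⇒good {t} (square m₀ m₁ m₂ m₃ m₄ m₅ m₆ m₇ m₈)
    ((((counted@(mkSemimagic _ _ (s , lines) , ((m₀>0 , _) ∷ _ ∷ (_ , m₂<t) ∷ _))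
       , _ , _ , _ , m₀<m₅ , _ , m₀<m₈) , _) , m₃<m₆) , m₁<m₃) =
    x , (((((((size , unequal 3F 4F ∘ from entry-3-4)
      , unequal 1F 4F ∘ from entry-1-4)
      , unequal 5F 8F ∘ from entry-5-8 ∘ sym)
      , unequal 1F 7F ∘ from entry-1-7)
      , unequal 7F 8F ∘ from entry-7-8 ∘ sym)
      , unequal 4F 7F ∘ from entry-4-7 ∘ sym)
      , unequal 4F 5F ∘ from entry-4-5 ∘ sym) , reconstructed
    where
    -- A strict inequality unfolds to `suc m ≤ n`, so each witness is a gap less one, just what a
    -- coordinate records.
    a = proj₁ (ℕ.m≤n⇒∃[o]m+o≡n m₀>0)
    f = proj₁ (ℕ.m≤n⇒∃[o]m+o≡n m₀<m₈)
    i = proj₁ (ℕ.m≤n⇒∃[o]m+o≡n m₀<m₅)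
    j = proj₁ (ℕ.m≤n⇒∃[o]m+o≡n m₁<m₃)
    k′ = proj₁ (ℕ.m≤n⇒∃[o]m+o≡n m₃<m₆)
    l = proj₁ (ℕ.m≤n⇒∃[o]m+o≡n m₂<t)
    open Entries a f i j k′
    x = l ∷ a ∷ f ∷ i ∷ j ∷ k′ ∷ []

    reconstructed : normalSquare x ≡ square m₀ m₁ m₂ m₃ m₄ m₅ m₆ m₇ m₈
    reconstructed = reconstruct l
      (proj₂ (ℕ.m≤n⇒∃[o]m+o≡n m₀>0)) (proj₂ (ℕ.m≤n⇒∃[o]m+o≡n m₀<m₈))
      (proj₂ (ℕ.m≤n⇒∃[o]m+o≡n m₀<m₅)) (proj₂ (ℕ.m≤n⇒∃[o]m+o≡n m₁<m₃))
      (proj₂ (ℕ.m≤n⇒∃[o]m+o≡n m₃<m₆)) lines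

    unequal : ∀ p q {_ : False (p Fin.≟ q)} →
              lookup (concat (normalSquare x)) p ≢ lookup (concat (normalSquare x)) q
    unequal p q {p≢q} = apart (normalSquare x) (subst (IsCounted t) (sym reconstructed) counted) p q {p≢q}

    corner≡ : entry 2F (a ∷ f ∷ i ∷ j ∷ k′ ∷ []) ≡ m₂
    corner≡ = cong (λ { (square _ _ m₂ _ _ _ _ _ _) → m₂ }) reconstructed

    size : weight x ≡ t
    size = trans (weight-corner l _) (trans (cong (suc l ℕ.+_) corner≡)
      (trans (cong suc (ℕ.+-comm l m₂)) (proj₂ (ℕ.m≤n⇒∃[o]m+o≡n m₂<t))))

  coordinates : ℕ → Matrix → Vec ℕ 6
  coordinates t (square m₀ m₁ m₂ m₃ m₄ m₅ m₆ m₇ m₈) =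
    t ∸ suc m₂ ∷ m₀ ∸ 1 ∷ m₈ ∸ suc m₀ ∷ m₅ ∸ suc m₀ ∷ m₃ ∸ suc m₁ ∷ m₆ ∸ suc m₃ ∷ []

  coordinates-normalSquare : ∀ {x} → Good t x → coordinates t (normalSquare x) ≡ x
  coordinates-normalSquare {x = l ∷ a ∷ f ∷ i ∷ j ∷ k ∷ []} (((((((size , _) , _) , _) , _) , _) , _) , _) =
    cong₂ _∷_ (difference (trans (cong suc (ℕ.+-comm (entry 2F v) l)) (trans (sym (weight-corner l v)) size)))
    (cong₂ _∷_ (difference gap-0) (cong₂ _∷_ (difference gap-8) (cong₂ _∷_ (difference gap-5)
    (cong₂ _∷_ (difference gap-3) (cong₂ _∷_ (difference gap-6) refl)))))
    where
    open Entries a f i j k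
    v = a ∷ f ∷ i ∷ j ∷ k ∷ []
    difference : ∀ {m n o} → m + n ≡ o → o ∸ m ≡ n
    difference {m} {n} refl = ℕ.m+n∸m≡n m n

  normalSquare-injective : ∀ {x y} → Good t x → Good t y → normalSquare x ≡ normalSquare y → x ≡ y
  normalSquare-injective {t} gx gy eq = trans (sym (coordinates-normalSquare gx))
    (trans (cong (coordinates t) eq) (coordinates-normalSquare gy))

  normal-size : Good t HasSize n → Normal t HasSize n
  normal-size = size-image normalSquare normalSquare-injective good⇒normal (λ {M} → normal⇒good M)

open Reconstruction

-- The rational generating function and the formula over the integers

module Quasipolynomial where

  open import Data.List.Base using (length; replicate; concat)
  open import Data.Nat.Base using (_+_; _*_)
  open ℤ.+-*-Solver using (solve; _:+_; _:*_; _:-_; _:=_; con)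
  open IsPolynomial

  Sc-size : ∀ t → IsCounted t HasSize Sc t
  Sc-size t = record
    { elements = semimagicSquares t
    ; unique   = semimagicSquares-unique t
    ; sound    = λ {M} → Equivalence.to (semimagicSquares-members t M)
    ; complete = λ {M} → Equivalence.from (semimagicSquares-members t M)
    ; size     = refl
    }

  Sc≡72*good : ∀ t → + Sc t ≡ + 72 ℤ.* goodSeries t
  Sc≡72*good t = rewritten (counts-good t)
    where
    open ≡-Reasoning
    rewritten : ∀ {z} → ∃[ n ] Good t HasSize n × z ≡ + n → + Sc t ≡ + 72 ℤ.* z
    rewritten {z} (n , good , eq) = begin
      + Sc t                               ≡⟨ cong +_ (size-unique (Sc-size t) (counted-size (normal-size good))) ⟩
      + (72 * n)                           ≡⟨ ℤ.pos-* 72 n ⟩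
      + 72 ℤ.* + n                         ≡⟨ cong (+ 72 ℤ.*_) eq ⟨
      + 72 ℤ.* z                           ∎

  generatingSeries-Sc : generatingSeries Sc ≈ₛ + 72 ◂ goodSeries
  generatingSeries-Sc zero    = Sc≡72*good 0
  generatingSeries-Sc (suc t) = Sc≡72*good (suc t)

  denominator-•-Sc : denominatorPoly • generatingSeries Sc ≈ₛ ⟦ numeratorPoly ⟧
  denominator-•-Sc = ≈-trans (•-cong denominatorPoly generatingSeries-Sc) denominator-•-goodSeries

  rationalForm : generatingSeries Sc ≈ ScNumerator ÷ ScDenominator
  rationalForm = inverse , isInverse , •-cancel denominatorTail (≈-trans denominator-•-Sc (≈-sym cleared-product))
    where
    inverse : Series
    inverse = quotient denominatorTail 1ₛ

    isInverse : ScDenominator ⊛ inverse ≈ₛ 1ₛ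
    isInverse = ≈-trans (⊛-cong {g = inverse} ScDenominator-⟦⟧ (λ _ → refl))
      (≈-trans (⟦⟧-⊛ denominatorPoly inverse) (•-quotient denominatorTail 1ₛ))

    -- Commutativity is wanted for this one pair of explicit polynomials, so comparing coefficients
    -- settles it.
    commute : numeratorPoly ⊠ denominatorPoly ≡ denominatorPoly ⊠ numeratorPoly
    commute = toWitness {a? = numeratorPoly ⊠ denominatorPoly ≟ₚ denominatorPoly ⊠ numeratorPoly} _

    cleared-product : denominatorPoly • (ScNumerator ⊛ inverse) ≈ₛ ⟦ numeratorPoly ⟧
    cleared-product =
      ≈-trans (•-cong denominatorPoly (≈-trans (⊛-cong {g = inverse} ScNumerator-⟦⟧ (λ _ → refl))
                                               (⟦⟧-⊛ numeratorPoly inverse)))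
      (≈-trans (≈-sym (⊠-• denominatorPoly numeratorPoly inverse))
      (≈-trans (λ n → cong (λ p → (p • inverse) n) (sym commute))
      (≈-trans (⊠-• numeratorPoly denominatorPoly inverse)
               (•-cong numeratorPoly (•-quotient denominatorTail 1ₛ)))))

  ⟦⟧-beyond : ∀ p n → ⟦ p ⟧ (length p + n) ≡ 0ℤ
  ⟦⟧-beyond []      n = refl
  ⟦⟧-beyond (a ∷ p) n = cong₂ ℤ._+_ (ℤ.*-zeroʳ a) (⟦⟧-beyond p n)

  -- Killed d u says that the d-th difference of u with step suc w vanishes; for a rational function with
  -- denominator dividing (1 - x^(suc w))^d this holds beyond the degree of the polynomial part.

  module Differences (w : ℕ) where

    Δ : (ℕ → ℤ) → ℕ → ℤ
    Δ u n = u (suc w + n) ℤ.- u n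

    data Killed : ℕ → (ℕ → ℤ) → Set where
      zero : ∀ {u} → (∀ n → u n ≡ 0ℤ) → Killed zero u
      suc  : ∀ {d u} → Killed d (Δ u) → Killed (suc d) u

    killed-cong : ∀ {d u v} → u ≗ v → Killed d u → Killed d v
    killed-cong u≗v (zero k) = zero (λ n → trans (sym (u≗v n)) (k n))
    killed-cong u≗v (suc k)  = suc (killed-cong (λ n → cong₂ ℤ._-_ (u≗v (suc w + n)) (u≗v n)) k)

    killed-+ : ∀ {d u v} → Killed d u → Killed d v → Killed d (λ n → u n ℤ.+ v n)
    killed-+         (zero ku) (zero kv) = zero (λ n → cong₂ ℤ._+_ (ku n) (kv n))
    killed-+ {_} {u} {v} (suc ku)  (suc kv)  = suc (killed-cong
      (λ n → solve 4 (λ a b c d → (a :- b) :+ (c :- d) := (a :+ c) :- (b :+ d)) refl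
        (u (suc w + n)) (u n) (v (suc w + n)) (v n))
      (killed-+ ku kv))

    killed-* : ∀ {d u} c → Killed d u → Killed d (λ n → c ℤ.* u n)
    killed-*         c (zero k) = zero (λ n → trans (cong (c ℤ.*_) (k n)) (ℤ.*-zeroʳ c))
    killed-* {_} {u} c (suc k)  = suc (killed-cong
      (λ n → solve 3 (λ c a b → c :* (a :- b) := c :* a :- c :* b) refl c (u (suc w + n)) (u n))
      (killed-* c k))

    killed-suc : ∀ {d u} → Killed d u → Killed (suc d) u
    killed-suc (zero k) = suc (zero (λ n → cong₂ ℤ._-_ (k (suc w + n)) (k n)))
    killed-suc (suc k)  = suc (killed-suc k)

    killed-raise : ∀ d {u} → Killed 1 u → Killed (suc d) u
    killed-raise zero    k = k
    killed-raise (suc d) k = killed-suc (killed-raise d k)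

    killed-shift : ∀ {d u} → Killed d u → Killed d (λ n → u (suc w + n))
    killed-shift (zero k) = zero (λ n → k (suc w + n))
    killed-shift (suc k)  = suc (killed-shift k)

    killed-tail : ∀ {d u} → Killed d u → Killed d (λ n → u (suc n))
    killed-tail         (zero k) = zero (λ n → k (suc n))
    killed-tail {_} {u} (suc k)  = suc (killed-cong
      (λ n → cong (λ i → u i ℤ.- u (suc n)) (ℕ.+-suc (suc w) n)) (killed-tail k))

    -- Leibniz: Δ (n u) = n Δ u + (w + 1) u(n + w + 1).
    killed-n* : ∀ {d u} → Killed d u → Killed (suc d) (λ n → + n ℤ.* u n)
    killed-n*             (zero k) = killed-suc (zero (λ n → trans (cong (+ n ℤ.*_) (k n)) (ℤ.*-zeroʳ (+ n))))
    killed-n* {suc d} {u} (suc k)  = suc (killed-cong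
      (λ n → solve 4 (λ p n a b → n :* (a :- b) :+ p :* a := (p :+ n) :* a :- n :* b) refl
        (+ suc w) (+ n) (u (suc w + n)) (u n))
      (killed-+ (killed-n* k) (killed-* (+ suc w) (killed-shift {_} {u} (suc k)))))

    killed-horner : ∀ {d p u} → Killed 1 p → Killed (suc d) u →
                    Killed (suc (suc d)) (λ n → p n ℤ.+ + n ℤ.* u n)
    killed-horner kp ku = killed-+ (killed-raise _ kp) (killed-n* ku)

    -- By induction on `d` the difference vanishes everywhere. The values then repeat with step
    -- `suc w`, and the initial ones decide.
    killed-zero : ∀ {d u} → Killed d u → (∀ n → n < d * suc w → u n ≡ 0ℤ) → ∀ n → u n ≡ 0ℤ
    killed-zero             (zero k) _       = k
    killed-zero {suc d} {u} (suc k)  initial = <-rec _ step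
      where
      Δu≡0 : ∀ n → Δ u n ≡ 0ℤ
      Δu≡0 = killed-zero k λ n n< → cong₂ ℤ._-_
        (initial (suc w + n) (ℕ.+-monoʳ-< (suc w) n<))
        (initial n (ℕ.<-≤-trans n< (ℕ.m≤n+m (d * suc w) (suc w))))

      step : ∀ n → (∀ {m} → m < n → u m ≡ 0ℤ) → u n ≡ 0ℤ
      step n rec with n ℕ.<? suc d * suc w
      ... | yes n< = initial n n<
      ... | no n≮ = earlier (ℕ.m≤n⇒∃[o]m+o≡n (ℕ.≤-trans (ℕ.m≤m+n (suc w) (d * suc w)) (ℕ.≮⇒≥ n≮)))
        where
        earlier : ∃[ m ] suc w + m ≡ n → u n ≡ 0ℤ
        earlier (m , refl) = trans (ℤ.i-j≡0⇒i≡j (u (suc w + m)) (u m) (Δu≡0 m)) (rec (ℕ.m<n+m m ℕ.z<s))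

    killed-unique : ∀ {d u v} → Killed d u → Killed d v →
                    (∀ n → n < d * suc w → u n ≡ v n) → ∀ n → u n ≡ v n
    killed-unique {_} {u} {v} ku kv agree n = ℤ.i-j≡0⇒i≡j (u n) (v n)
      (killed-zero (killed-cong (λ n → cong (ℤ._+_ (u n)) (ℤ.-1*i≡-i (v n))) (killed-+ ku (killed-* -1ℤ kv)))
        (λ n n< → ℤ.i≡j⇒i-j≡0 (agree n n<)) n)

    -- From index `suc w` on, multiplication by 1 - x^(suc w) takes a difference with step `suc w`.
    -- Each factor peeled off therefore moves `suc w` from the multiple of `d` into the offset `m`.
    killed-denominator : ∀ d s m →
      (∀ n → (coneDenominator (Vec.replicate d (suc w)) • s) (d * suc w + m + n) ≡ 0ℤ) →
      Killed d (λ n → s (m + n))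
    killed-denominator zero    s m eq = zero (λ n → trans (sym ((1• s) (m + n))) (eq n))
    killed-denominator (suc d) s m eq = suc (killed-cong difference
      (killed-denominator d ((1-x^ suc w) • s) (suc w + m) λ n →
        trans (sym (⊠-• (coneDenominator (Vec.replicate d (suc w))) (1-x^ suc w) s _))
          (trans (cong (coneDenominator (Vec.replicate (suc d) (suc w)) • s) (cong (_+ n) (rearrange (d * suc w)))) (eq n))))
      where
      open ≡-Reasoning
      rearrange : ∀ e → e + (suc w + m) ≡ suc w + e + m
      rearrange e = trans (sym (ℕ.+-assoc e (suc w) m)) (cong (_+ m) (ℕ.+-comm e (suc w)))

      swap-front : ∀ a b c → a + (b + c) ≡ b + (a + c)
      swap-front a b c = trans (sym (ℕ.+-assoc a b c)) (trans (cong (_+ c) (ℕ.+-comm a b)) (ℕ.+-assoc b a c))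

      difference : ∀ n → ((1-x^ suc w) • s) (suc w + m + n) ≡ s (m + (suc w + n)) ℤ.- s (m + n)
      difference n = begin
        ((1-x^ suc w) • s) (suc w + m + n)      ≡⟨ cong ((1-x^ suc w) • s) (ℕ.+-assoc (suc w) m n) ⟩
        ((1-x^ suc w) • s) (suc w + (m + n))    ≡⟨ 1-x^-+ w s (m + n) ⟩
        s (suc w + (m + n)) ℤ.- s (m + n)       ≡⟨ cong (λ i → s i ℤ.- s (m + n)) (swap-front (suc w) m n) ⟩
        s (m + (suc w + n)) ℤ.- s (m + n)       ∎

    killed-rational : ∀ {s} d m cofactor p q → p • s ≈ₛ ⟦ q ⟧ →
                      cofactor ⊠ p ≡ coneDenominator (Vec.replicate d (suc w)) →
                      length (cofactor ⊠ q) ≡ d * suc w + m →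
                      Killed d (λ n → s (m + n))
    killed-rational {s} d m cofactor p q eq factorisation degree = killed-denominator d s m λ n →
      trans (cong (λ r → (r • s) (d * suc w + m + n)) (sym factorisation))
      (trans (⊠-• cofactor p s _)
      (trans (•-cong cofactor eq _)
      (trans (sym (⊠-• cofactor q 1ₛ _))
      (subst (λ l → ⟦ cofactor ⊠ q ⟧ (l + n) ≡ 0ℤ) degree (⟦⟧-beyond (cofactor ⊠ q) n)))))

  -- The step is `suc 59`, the least common multiple of 2, 3, 4 and 5.
  open Differences 59

  -- (1 - x^(m w)) / (1 - x^w)
  geometric : ℕ → ℕ → Polyℤ
  geometric m w = 1ℤ ∷ concat (replicate (pred m) (monomial 1ℤ (pred w)))

  -- Expanding the denominator to (1 - x^60)^6, of degree 360, turns the numerator into a polynomial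
  -- of degree 360 as well, that is, a list of 361 coefficients. Hence the offset 1.
  killed-Sc : Killed 6 (λ n → generatingSeries Sc (suc n))
  killed-Sc = killed-rational {generatingSeries Sc} 6 1 cofactor denominatorPoly numeratorPoly denominator-•-Sc
    (toWitness {a? = cofactor ⊠ denominatorPoly ≟ₚ coneDenominator (Vec.replicate 6 60)} _)
    (toWitness {a? = length (cofactor ⊠ numeratorPoly) ℕ.≟ 361} _)
    where
    cofactor : Polyℤ
    cofactor = geometric 30 2 ⊠ (geometric 30 2 ⊠ (geometric 20 3 ⊠
      (geometric 20 3 ⊠ (geometric 15 4 ⊠ geometric 12 5))))

  -- 120 clears the denominators of the coefficients; constantTable lists 120 c₀, entering with a minus sign.

  quadraticTable : Vec ℤ 2
  quadraticTable = -[1+ 71867 ] ∷ -[1+ 71597 ] ∷ []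

  linearTable : Vec ℤ 6
  linearTable = + 175680 ∷ + 169860 ∷ + 175680 ∷ + 170820 ∷ + 174720 ∷ + 170820 ∷ []

  constantTable : Vec (Vec ℤ 5) 12
  constantTable =
    (+ 155520 ∷ + 155520 ∷ + 158976 ∷ + 148608 ∷ + 158976 ∷ []) ∷
    (+ 110413 ∷ + 120781 ∷ + 117325 ∷ + 117325 ∷ + 120781 ∷ []) ∷
    (+ 152960 ∷ + 156416 ∷ + 146048 ∷ + 156416 ∷ + 152960 ∷ []) ∷
    (+ 143181 ∷ + 139725 ∷ + 139725 ∷ + 143181 ∷ + 132813 ∷ []) ∷
    (+ 145216 ∷ + 134848 ∷ + 145216 ∷ + 141760 ∷ + 141760 ∷ []) ∷
    (+ 128525 ∷ + 128525 ∷ + 131981 ∷ + 121613 ∷ + 131981 ∷ []) ∷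
    (+ 148608 ∷ + 158976 ∷ + 155520 ∷ + 155520 ∷ + 158976 ∷ []) ∷
    (+ 125965 ∷ + 129421 ∷ + 119053 ∷ + 129421 ∷ + 125965 ∷ []) ∷
    (+ 156416 ∷ + 152960 ∷ + 152960 ∷ + 156416 ∷ + 146048 ∷ []) ∷
    (+ 134541 ∷ + 124173 ∷ + 134541 ∷ + 131085 ∷ + 131085 ∷ []) ∷
    (+ 141760 ∷ + 141760 ∷ + 145216 ∷ + 134848 ∷ + 145216 ∷ []) ∷
    (+ 130253 ∷ + 140621 ∷ + 137165 ∷ + 137165 ∷ + 140621 ∷ []) ∷ []

  constantEntry : Fin 60 → ℤ
  constantEntry i = let k , r = remQuot {5} 12 i in lookup (lookup constantTable r) k

  quadratic linear₁ constant : ℕ → ℤ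
  quadratic t = lookup quadraticTable (t mod 2)
  linear₁ t   = lookup linearTable (t mod 6)
  constant t  = ℤ.- constantEntry (t mod 60)

  120*quasi : ℕ → ℤ
  120*quasi t = constant t ℤ.+ + t ℤ.* (linear₁ t ℤ.+ + t ℤ.* (quadratic t ℤ.+ + t ℤ.*
    (+ 13240 ℤ.+ + t ℤ.* (-[1+ 1124 ] ℤ.+ + t ℤ.* + 36))))

  mod-cong : ∀ {m n} d .{{_ : NonZero d}} → m % d ≡ n % d → m mod d ≡ n mod d
  mod-cong {m} {n} d eq = Fin.toℕ-injective
    (trans (Fin.toℕ-fromℕ< (m%n<n m d)) (trans eq (sym (Fin.toℕ-fromℕ< (m%n<n n d)))))

  killed-const : ∀ c → Killed 1 (λ _ → c)
  killed-const c = suc (zero (λ _ → ℤ.i≡j⇒i-j≡0 {c} refl))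

  killed-mod : ∀ d .{{_ : NonZero d}} (f : Fin d → ℤ) → d ∣ 60 → Killed 1 (λ n → f (n mod d))
  killed-mod d f d∣60 = suc (zero (λ n →
    ℤ.i≡j⇒i-j≡0 {f ((60 + n) mod d)} (cong f (mod-cong {60 + n} {n} d (%-remove-+ˡ n d∣60)))))

  -- One difference kills a periodic coefficient, and each of the five multiplications by t in
  -- Horner's scheme costs one more.
  killed-120*quasi : Killed 6 120*quasi
  killed-120*quasi =
    killed-horner (killed-mod 60 (λ i → ℤ.- constantEntry i) (divides 1 refl))
    (killed-horner (killed-mod 6 (lookup linearTable) (divides 10 refl))
    (killed-horner (killed-mod 2 (lookup quadraticTable) (divides 30 refl))
    (killed-horner (killed-const (+ 13240))
    (killed-horner (killed-const -[1+ 1124 ]) (killed-const (+ 36))))))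

  prefix-agree : ∀ {u v} N → prefix u N ≡ prefix v N → ∀ {n} → n ≤ N → u n ≡ v n
  prefix-agree zero    eq ℕ.z≤n = List.∷-injectiveˡ eq
  prefix-agree (suc N) eq n≤1+N with ℕ.m≤n⇒m<n∨m≡n n≤1+N
  ... | inj₁ n≤N  = prefix-agree N (List.∷-injectiveʳ eq) (ℕ.≤-pred n≤N)
  ... | inj₂ refl = List.∷-injectiveˡ eq

  prefix-◂ : ∀ c s n → prefix (c ◂ s) n ≡ List.map (c ℤ.*_) (prefix s n)
  prefix-◂ c s zero    = refl
  prefix-◂ c s (suc n) = cong (c ℤ.* s (suc n) ∷_) (prefix-◂ c s n)

  agree-up-to : ∀ {p s u} c v N → (1ℤ ∷ p) • u ≈ₛ s → List.map (c ℤ.*_) (quotientPrefix p s N) ≡ prefix v N →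
                ∀ {n} → n ≤ N → c ℤ.* u n ≡ v n
  agree-up-to {p} {s} {u} c v N eq values = prefix-agree {c ◂ u} {v} N
    (trans (prefix-◂ c u N) (trans (cong (List.map (c ℤ.*_)) (quotient-unique {p} {s} {u} eq N)) values))

  -- Long division of the rational function yields the coefficients, which are compared with the
  -- formula in one computation.
  initial-Sc : ∀ n → n < 360 → + 120 ℤ.* generatingSeries Sc (suc n) ≡ 120*quasi (suc n)
  initial-Sc n = agree-up-to {denominatorTail} {⟦ numeratorPoly ⟧} {generatingSeries Sc} (+ 120) target 360
    denominator-•-Sc
    (toWitness {a? = List.map (+ 120 ℤ.*_) (quotientPrefix denominatorTail ⟦ numeratorPoly ⟧ 360)
                       ≟ₚ prefix target 360} _)
    where
    -- At 0 the generating series vanishes but the quasipolynomial does not.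
    target : Series
    target zero    = 0ℤ
    target (suc n) = 120*quasi (suc n)

  120*Sc : ∀ n → + 120 ℤ.* + Sc (suc n) ≡ 120*quasi (suc n)
  120*Sc = killed-unique (killed-* (+ 120) killed-Sc) (killed-tail killed-120*quasi) initial-Sc

open Quasipolynomial

open import Data.List.Base using (length)
open import Data.Rational.Base as ℚ using (ℚ; 0ℚ; 1ℚ; _/_; _+_; _-_; _*_; -_)
import Data.Rational.Properties as ℚ
import Data.Rational.Solver as ℚ
import Data.Rational.Unnormalised.Base as ℚᵘ
import Data.Rational.Unnormalised.Properties as ℚᵘ
open ℚ.+-*-Solver using (solve; _:+_; _:*_; _:-_; :-_; _:=_; con)

-- Polynomials over ℚ are determined by infinitely many values

_-ₚ_ : Poly → Poly → Poly
P       -ₚ []      = P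
[]      -ₚ (b ∷ Q) = - b ∷ [] -ₚ Q
(a ∷ P) -ₚ (b ∷ Q) = a - b ∷ P -ₚ Q

eval-- : ∀ P Q x → eval (P -ₚ Q) x ≡ eval P x - eval Q x
eval-- []      []      x = refl
eval-- (a ∷ P) []      x = sym (ℚ.+-identityʳ _)
eval-- []      (b ∷ Q) x = trans (cong (λ e → - b + x * e) (eval-- [] Q x))
  (solve 3 (λ b x q → :- b :+ x :* (con 0ℚ :- q) := con 0ℚ :- (b :+ x :* q)) refl b x (eval Q x))
eval-- (a ∷ P) (b ∷ Q) x = trans (cong (λ e → (a - b) + x * e) (eval-- P Q x))
  (solve 5 (λ a b x p q → (a :- b) :+ x :* (p :- q) := (a :+ x :* p) :- (b :+ x :* q)) refl a b x (eval P x) (eval Q x))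

coeff-- : ∀ P Q k → coeff (P -ₚ Q) k ≡ coeff P k - coeff Q k
coeff-- []      []      k       = refl
coeff-- (a ∷ P) []      k       = sym (ℚ.+-identityʳ _)
coeff-- []      (b ∷ Q) zero    = sym (ℚ.+-identityˡ (- b))
coeff-- []      (b ∷ Q) (suc k) = coeff-- [] Q k
coeff-- (a ∷ P) (b ∷ Q) zero    = refl
coeff-- (a ∷ P) (b ∷ Q) (suc k) = coeff-- P Q k

-- Synthetic division: horner x P is the quotient of a ∷ P by the linear factor with root x, for any a.
horner : ℚ → Poly → Poly
horner x []      = []
horner x (b ∷ P) = eval (b ∷ P) x ∷ horner x P

length-horner : ∀ x P → length (horner x P) ≡ length P
length-horner x []      = refl
length-horner x (b ∷ P) = cong suc (length-horner x P)

eval-horner : ∀ x a P y → eval (a ∷ P) y ≡ eval (a ∷ P) x + (y - x) * eval (horner x P) y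
eval-horner x a []      y = solve 3 (λ x a y → a :+ y :* con 0ℚ := (a :+ x :* con 0ℚ) :+ (y :- x) :* con 0ℚ) refl x a y
eval-horner x a (b ∷ P) y = trans (cong (λ e → a + y * e) (eval-horner x b P y))
  (solve 5 (λ x a y e q → a :+ y :* (e :+ (y :- x) :* q) := (a :+ x :* e) :+ (y :- x) :* (e :+ y :* q)) refl
    x a y (eval (b ∷ P) x) (eval (horner x P) y))

head≡0 : ∀ {a x e} → a + x * e ≡ 0ℚ → e ≡ 0ℚ → a ≡ 0ℚ
head≡0 {a} {x} eq refl = trans (solve 2 (λ a x → a := a :+ x :* con 0ℚ) refl a x) eq

-- The coefficients of `horner x P` are the values at `x` of the successive tails of `P`. If all of
-- them vanish, so does each coefficient, being the value of one tail minus `x` times that of the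
-- next.
horner-≈0 : ∀ x P → (∀ k → coeff (horner x P) k ≡ 0ℚ) → eval P x ≡ 0ℚ × (∀ k → coeff P k ≡ 0ℚ)
horner-≈0 x []      h = refl , λ _ → refl
horner-≈0 x (b ∷ P) h = h 0 , λ { zero → head≡0 {b} {x} (h 0) P≡0 ; (suc k) → P≈0 k }
  where
  P≡0 = proj₁ (horner-≈0 x P (h ∘ suc))
  P≈0 = proj₂ (horner-≈0 x P (h ∘ suc))

*-cancel-0 : ∀ {p q} → p ≢ 0ℚ → p * q ≡ 0ℚ → q ≡ 0ℚ
*-cancel-0 {p} {q} p≢0 pq≡0 = begin
  q                   ≡⟨ ℚ.*-identityˡ q ⟨
  1ℚ * q              ≡⟨ cong (_* q) (ℚ.*-inverseˡ p) ⟨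
  ℚ.1/ p * p * q      ≡⟨ ℚ.*-assoc (ℚ.1/ p) p q ⟩
  ℚ.1/ p * (p * q)    ≡⟨ cong (ℚ.1/ p *_) pq≡0 ⟩
  ℚ.1/ p * 0ℚ         ≡⟨ ℚ.*-zeroʳ (ℚ.1/ p) ⟩
  0ℚ                  ∎
  where
  open ≡-Reasoning
  instance p-nonZero = ℚ.≢-nonZero p≢0

-- The factor theorem: splitting off the root `x 0` leaves a shorter quotient that vanishes at all
-- other `x i`, since these differ from `x 0`.
vanishing : ∀ n P → length P ≤ n → (x : ℕ → ℚ) → (∀ {i j} → x i ≡ x j → i ≡ j) →
            (∀ i → eval P (x i) ≡ 0ℚ) → ∀ k → coeff P k ≡ 0ℚ
vanishing n       []      _         x x-inj root k = refl
vanishing (suc n) (a ∷ P) (ℕ.s≤s P≤n) x x-inj root =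
  λ { zero → head≡0 {a} {x 0} (root 0) (proj₁ P-zero) ; (suc k) → proj₂ P-zero k }
  where
  apart-roots : ∀ i → x (suc i) - x 0 ≢ 0ℚ
  apart-roots i eq = contradiction (x-inj
    (trans (solve 2 (λ u v → u := (u :- v) :+ v) refl (x (suc i)) (x 0))
     (trans (cong (_+ x 0) eq) (ℚ.+-identityˡ (x 0))))) λ ()

  root′ : ∀ i → eval (horner (x 0) P) (x (suc i)) ≡ 0ℚ
  root′ i = *-cancel-0 (apart-roots i) (begin
    (x (suc i) - x 0) * e              ≡⟨ ℚ.+-identityˡ _ ⟨
    0ℚ + (x (suc i) - x 0) * e         ≡⟨ cong (_+ (x (suc i) - x 0) * e) (root 0) ⟨
    eval (a ∷ P) (x 0) + (x (suc i) - x 0) * e  ≡⟨ eval-horner (x 0) a P (x (suc i)) ⟨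
    eval (a ∷ P) (x (suc i))           ≡⟨ root (suc i) ⟩
    0ℚ                                 ∎)
    where
    open ≡-Reasoning
    e = eval (horner (x 0) P) (x (suc i))

  P-zero : eval P (x 0) ≡ 0ℚ × (∀ k → coeff P k ≡ 0ℚ)
  P-zero = horner-≈0 (x 0) P
    (vanishing n (horner (x 0) P) (subst (_≤ n) (sym (length-horner (x 0) P)) P≤n) (x ∘ suc)
      (ℕ.suc-injective ∘ x-inj) root′)

agreeing : ∀ P Q (x : ℕ → ℚ) → (∀ {i j} → x i ≡ x j → i ≡ j) →
           (∀ i → eval P (x i) ≡ eval Q (x i)) → P ≈ₚ Q
agreeing P Q x x-inj agree k = begin
  coeff P k                        ≡⟨ solve 2 (λ p q → p := (p :- q) :+ q) refl (coeff P k) (coeff Q k) ⟩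
  coeff P k - coeff Q k + coeff Q k  ≡⟨ cong (_+ coeff Q k) (trans (sym (coeff-- P Q k))
                                          (vanishing _ (P -ₚ Q) ℕ.≤-refl x x-inj difference k)) ⟩
  0ℚ + coeff Q k                   ≡⟨ ℚ.+-identityˡ _ ⟩
  coeff Q k                        ∎
  where
  open ≡-Reasoning
  difference : ∀ i → eval (P -ₚ Q) (x i) ≡ 0ℚ
  difference i = trans (eval-- P Q (x i)) (trans (cong (_- eval Q (x i)) (agree i)) (ℚ.+-inverseʳ (eval Q (x i))))

-- From the integer identity scaled by 120 to the rational formula

ι : ℤ → ℚ
ι z = z / 1

toℚᵘ-ι : ∀ z → ℚ.toℚᵘ (ι z) ℚᵘ.≃ ℚᵘ.mkℚᵘ z 0
toℚᵘ-ι z = ℚ.toℚᵘ-fromℚᵘ (ℚᵘ.mkℚᵘ z 0)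

ι-injective : ∀ {y z} → ι y ≡ ι z → y ≡ z
ι-injective {y} {z} eq with ℚᵘ.*≡* y*1≡z*1 ←
  ℚᵘ.≃-trans (ℚᵘ.≃-sym (toℚᵘ-ι y)) (ℚᵘ.≃-trans (ℚᵘ.≃-reflexive (cong ℚ.toℚᵘ eq)) (toℚᵘ-ι z)) =
  trans (sym (ℤ.*-identityʳ y)) (trans y*1≡z*1 (ℤ.*-identityʳ z))

ι-+ : ∀ y z → ι (y ℤ.+ z) ≡ ι y + ι z
ι-+ y z = ℚ.toℚᵘ-injective (begin
  ℚ.toℚᵘ (ι (y ℤ.+ z))                  ≈⟨ toℚᵘ-ι (y ℤ.+ z) ⟩
  ℚᵘ.mkℚᵘ (y ℤ.+ z) 0                   ≈⟨ ℚᵘ.*≡* (cong (ℤ._* 1ℤ)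
                                              (cong₂ ℤ._+_ (sym (ℤ.*-identityʳ y)) (sym (ℤ.*-identityʳ z)))) ⟩
  ℚᵘ.mkℚᵘ y 0 ℚᵘ.+ ℚᵘ.mkℚᵘ z 0          ≈⟨ ℚᵘ.+-cong (toℚᵘ-ι y) (toℚᵘ-ι z) ⟨
  ℚ.toℚᵘ (ι y) ℚᵘ.+ ℚ.toℚᵘ (ι z)        ≈⟨ ℚ.toℚᵘ-homo-+ (ι y) (ι z) ⟨
  ℚ.toℚᵘ (ι y + ι z)                    ∎)
  where open ℚᵘ.≃-Reasoning

ι-* : ∀ y z → ι (y ℤ.* z) ≡ ι y * ι z
ι-* y z = ℚ.toℚᵘ-injective (begin
  ℚ.toℚᵘ (ι (y ℤ.* z))                  ≈⟨ toℚᵘ-ι (y ℤ.* z) ⟩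
  ℚᵘ.mkℚᵘ y 0 ℚᵘ.* ℚᵘ.mkℚᵘ z 0          ≈⟨ ℚᵘ.*-cong (toℚᵘ-ι y) (toℚᵘ-ι z) ⟨
  ℚ.toℚᵘ (ι y) ℚᵘ.* ℚ.toℚᵘ (ι z)        ≈⟨ ℚ.toℚᵘ-homo-* (ι y) (ι z) ⟨
  ℚ.toℚᵘ (ι y * ι z)                    ∎)
  where open ℚᵘ.≃-Reasoning

c₁-table : Vec ℚ 6
c₁-table = + 1464 / 1 ∷ + 2831 / 2 ∷ + 1464 / 1 ∷ + 2847 / 2 ∷ + 1456 / 1 ∷ + 2847 / 2 ∷ []

c₂-table : Vec ℚ 2
c₂-table = - (+ 5989 / 10) ∷ - (+ 11933 / 20) ∷ []

c₂ : ℕ → ℚ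
c₂ t = lookup c₂-table (t mod 2)

quintic : ℚ → ℚ → ℚ → Poly
quintic a b c = a ∷ b ∷ c ∷ + 331 / 3 ∷ - (+ 75 / 8) ∷ + 3 / 10 ∷ []

quintic-cong : ∀ {a a′ b b′ c c′} → a ≡ a′ → b ≡ b′ → c ≡ c′ → quintic a b c ≡ quintic a′ b′ c′
quintic-cong refl refl refl = refl

quasiPoly : ℕ → Poly
quasiPoly t = quintic (- c₀ t) (c₁ t) (c₂ t)

toℕ-mod : ∀ t d .{{_ : NonZero d}} → toℕ (t mod d) ≡ t % d
toℕ-mod t d = Fin.toℕ-fromℕ< (m%n<n t d)

toℕ-mod-mod : ∀ t d .{{_ : NonZero d}} → toℕ (t mod d) mod d ≡ t mod d
toℕ-mod-mod t d = mod-cong {toℕ (t mod d)} {t} d (trans (cong (_% d) (toℕ-mod t d)) (m%n%n≡m%n t d))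

1/120 : ℚ
1/120 = + 1 / 120

-- Both sides depend on `t mod 60` only, so sixty comparisons decide; likewise six and two in the
-- next lemmas.
c₀-scaled : ∀ t → 1/120 * ι (constant t) ≡ - c₀ t
c₀-scaled t = trans (table (t mod 60))
  (cong (λ i → let k , r = remQuot {5} 12 i in - lookup (lookup c₀-table r) k) (toℕ-mod-mod t 60))
  where
  table : ∀ i → 1/120 * ι (ℤ.- constantEntry i) ≡ - c₀ (toℕ i)
  table = toWitness {a? = Fin.all? (λ i → 1/120 * ι (ℤ.- constantEntry i) ℚ.≟ - c₀ (toℕ i))} _

c₁-scaled : ∀ t → 1/120 * ι (linear₁ t) ≡ c₁ t
c₁-scaled t = trans (table (t mod 6)) (cong (lookup c₁-table) (toℕ-mod-mod t 6))
  where
  table : ∀ i → 1/120 * ι (lookup linearTable i) ≡ c₁ (toℕ i)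
  table = toWitness {a? = Fin.all? (λ i → 1/120 * ι (lookup linearTable i) ℚ.≟ c₁ (toℕ i))} _

c₂-scaled : ∀ t → 1/120 * ι (quadratic t) ≡ c₂ t
c₂-scaled t = trans (table (t mod 2)) (cong (lookup c₂-table) (toℕ-mod-mod t 2))
  where
  table : ∀ i → 1/120 * ι (lookup quadraticTable i) ≡ c₂ (toℕ i)
  table = toWitness {a? = Fin.all? (λ i → 1/120 * ι (lookup quadraticTable i) ℚ.≟ c₂ (toℕ i))} _

ι-horner : ∀ t a {z e} → ι z ≡ e → ι (a ℤ.+ t ℤ.* z) ≡ ι a + ι t * e
ι-horner t a {z} refl = trans (ι-+ a (t ℤ.* z)) (cong (λ e → ι a + e) (ι-* t z))

ι-quintic : ∀ t a b c →
  ι (a ℤ.+ t ℤ.* (b ℤ.+ t ℤ.* (c ℤ.+ t ℤ.* (+ 13240 ℤ.+ t ℤ.* (-[1+ 1124 ] ℤ.+ t ℤ.* + 36))))) ≡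
  ι a + ι t * (ι b + ι t * (ι c + ι t * (ι (+ 13240) + ι t * (ι -[1+ 1124 ] + ι t * ι (+ 36)))))
ι-quintic t a b c = ι-horner t a (ι-horner t b (ι-horner t c (ι-horner t (+ 13240) (ι-horner t -[1+ 1124 ] refl))))

-- 13240, -1125 and 36 are 120 times 331/3, -75/8 and 3/10.
scaled-quintic : ∀ T x y z →
  1/120 * (x + T * (y + T * (z + T * (ι (+ 13240) + T * (ι -[1+ 1124 ] + T * ι (+ 36)))))) ≡
  eval (quintic (1/120 * x) (1/120 * y) (1/120 * z)) T
scaled-quintic = solve 4 (λ T x y z →
  con 1/120 :* (x :+ T :* (y :+ T :* (z :+ T :* (con (ι (+ 13240)) :+ T :* (con (ι -[1+ 1124 ]) :+ T :* con (ι (+ 36)))))))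
  := con 1/120 :* x :+ T :* (con 1/120 :* y :+ T :* (con 1/120 :* z :+ T :* (con (+ 331 / 3)
       :+ T :* (con (- (+ 75 / 8)) :+ T :* (con (+ 3 / 10) :+ T :* con 0ℚ)))))) refl

ι-quintic-unscaled : ∀ s t a b c →
  + 120 ℤ.* s ≡ a ℤ.+ t ℤ.* (b ℤ.+ t ℤ.* (c ℤ.+ t ℤ.* (+ 13240 ℤ.+ t ℤ.* (-[1+ 1124 ] ℤ.+ t ℤ.* + 36)))) →
  ι s ≡ eval (quintic (1/120 * ι a) (1/120 * ι b) (1/120 * ι c)) (ι t)
ι-quintic-unscaled s t a b c eq = begin
  ι s                           ≡⟨ solve 1 (λ s → s := con 1/120 :* (con (ι (+ 120)) :* s)) refl (ι s) ⟩
  1/120 * (ι (+ 120) * ι s)     ≡⟨ cong (1/120 *_) (ι-* (+ 120) s) ⟨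
  1/120 * ι (+ 120 ℤ.* s)       ≡⟨ cong (1/120 *_) (trans (cong ι eq) (ι-quintic t a b c)) ⟩
  _                             ≡⟨ scaled-quintic (ι t) (ι a) (ι b) (ι c) ⟩
  eval (quintic (1/120 * ι a) (1/120 * ι b) (1/120 * ι c)) (ι t) ∎
  where open ≡-Reasoning

Sc≡eval : ∀ t → t ≥ 1 → ℕ→ℚ (Sc t) ≡ eval (quasiPoly t) (ℕ→ℚ t)
Sc≡eval (suc n) _ = trans
  (ι-quintic-unscaled (+ Sc t) (+ t) (constant t) (linear₁ t) (quadratic t) (120*Sc n))
  (cong (λ P → eval P (ℕ→ℚ t)) (quintic-cong (c₀-scaled t) (c₁-scaled t) (c₂-scaled t)))
  where t = suc n

eval-quintic : ∀ T x y z → eval (quintic (- x) y (- z)) T ≡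
  (+ 3 / 10) * T ^ 5 - (+ 75 / 8) * T ^ 4 + (+ 331 / 3) * T ^ 3 - z * T ^ 2 + y * T - x
eval-quintic = solve 4 (λ T x y z →
  :- x :+ T :* (y :+ T :* (:- z :+ T :* (con (+ 331 / 3) :+ T :* (con (- (+ 75 / 8)) :+ T :* (con (+ 3 / 10) :+ T :* con 0ℚ)))))
  := con (+ 3 / 10) :* (T :* (T :* (T :* (T :* (T :* con 1ℚ))))) :- con (+ 75 / 8) :* (T :* (T :* (T :* (T :* con 1ℚ))))
     :+ con (+ 331 / 3) :* (T :* (T :* (T :* con 1ℚ))) :- z :* (T :* (T :* con 1ℚ)) :+ y :* T :- x) refl

polynomialForm : ∀ t c → t ≥ 1 → c₂ t ≡ - c → ℕ→ℚ (Sc t) ≡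
  (+ 3 / 10) * ℕ→ℚ t ^ 5 - (+ 75 / 8) * ℕ→ℚ t ^ 4 + (+ 331 / 3) * ℕ→ℚ t ^ 3 - c * ℕ→ℚ t ^ 2 + c₁ t * ℕ→ℚ t - c₀ t
polynomialForm t c t≥1 eq = trans (Sc≡eval t t≥1)
  (trans (cong (λ d → eval (quintic (- c₀ t) (c₁ t) d) (ℕ→ℚ t)) eq) (eval-quintic (ℕ→ℚ t) (c₀ t) (c₁ t) c))

c₂-even : ∀ t → 2 ∣ t → c₂ t ≡ - (+ 5989 / 10)
c₂-even t 2∣t = cong (lookup c₂-table) (mod-cong {t} {0} 2 (n∣m⇒m%n≡0 t 2 2∣t))

c₂-odd : ∀ t → 2 ∤ t → c₂ t ≡ - (+ 11933 / 20)
c₂-odd t 2∤t = cong (lookup c₂-table) (mod-cong {t} {1} 2 (odd (t % 2) (m%n<n t 2) (2∤t ∘ m%n≡0⇒n∣m t 2)))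
  where
  odd : ∀ r → r < 2 → r ≢ 0 → r ≡ 1
  odd 0 _ r≢0 = contradiction refl r≢0
  odd 1 _ _   = refl
  odd (suc (suc _)) (ℕ.s≤s (ℕ.s≤s ())) _

-- Uniqueness of the constituents and minimality of the period

quasiPoly-cong : ∀ {s t} → s % 60 ≡ t % 60 → quasiPoly s ≡ quasiPoly t
quasiPoly-cong {s} {t} eq = quintic-cong
  (cong (λ i → let k , r = remQuot {5} 12 i in - lookup (lookup c₀-table r) k) (mod-cong {s} {t} 60 eq))
  (cong (lookup c₁-table) (mod-cong {s} {t} 6 (coarsen 6 (divides 10 refl))))
  (cong (lookup c₂-table) (mod-cong {s} {t} 2 (coarsen 2 (divides 30 refl))))
  where
  coarsen : ∀ d .{{_ : NonZero d}} → d ∣ 60 → s % d ≡ t % d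
  coarsen d d∣60 = trans (sym (m∣n⇒o%n%m≡o%m d 60 s d∣60)) (trans (cong (_% d) eq) (m∣n⇒o%n%m≡o%m d 60 t d∣60))

constituents : Constituents (λ t → ℕ→ℚ (Sc t)) 60
constituents = record
  { constituent = λ r → quasiPoly (toℕ r)
  ; agrees      = λ t t≥1 → trans (Sc≡eval t t≥1) (cong (λ P → eval P (ℕ→ℚ t))
      (quasiPoly-cong {t} {toℕ (t mod 60)} (sym (trans (cong (_% 60) (toℕ-mod t 60)) (m%n%n≡m%n t 60)))))
  }

-- Along the progression s + 60qk both residues, modulo q and modulo 60, stay fixed. The two
-- polynomials thus agree at infinitely many arguments.
constituent-unique : ∀ {q} .{{_ : NonZero q}} (C : Constituents (λ t → ℕ→ℚ (Sc t)) q) s → s ≥ 1 →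
                     Constituents.constituent C (s mod q) ≈ₚ quasiPoly s
constituent-unique {q} C s s≥1 = agreeing (Constituents.constituent C (s mod q)) (quasiPoly s) (ℕ→ℚ ∘ point) point-injective agree
  where
  open Constituents C
  point : ℕ → ℕ
  point k = s ℕ.+ k ℕ.* (60 ℕ.* q)

  point-injective : ∀ {i j} → ℕ→ℚ (point i) ≡ ℕ→ℚ (point j) → i ≡ j
  point-injective {i} {j} eq = ℕ.*-cancelʳ-≡ i j (60 ℕ.* q) {{ℕ.m*n≢0 60 q}}
    (ℕ.+-cancelˡ-≡ s _ _ (ℤ.+-injective (ι-injective eq)))

  agree : ∀ k → eval (constituent (s mod q)) (ℕ→ℚ (point k)) ≡ eval (quasiPoly s) (ℕ→ℚ (point k))
  agree k = begin
    eval (constituent (s mod q)) (ℕ→ℚ (point k))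
      ≡⟨ cong (λ r → eval (constituent r) (ℕ→ℚ (point k)))
           (mod-cong {s} {point k} q (sym (%-remove-+ʳ s (divides (k ℕ.* 60) (sym (ℕ.*-assoc k 60 q)))))) ⟩
    eval (constituent (point k mod q)) (ℕ→ℚ (point k))
      ≡⟨ agrees (point k) (ℕ.≤-trans s≥1 (ℕ.m≤m+n s _)) ⟨
    ℕ→ℚ (Sc (point k))
      ≡⟨ Sc≡eval (point k) (ℕ.≤-trans s≥1 (ℕ.m≤m+n s _)) ⟩
    eval (quasiPoly (point k)) (ℕ→ℚ (point k))
      ≡⟨ cong (λ P → eval P (ℕ→ℚ (point k))) (quasiPoly-cong {point k} {s}
           (%-remove-+ʳ s (divides (k ℕ.* q) (trans (cong (k ℕ.*_) (ℕ.*-comm 60 q)) (sym (ℕ.*-assoc k q 60)))))) ⟩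
    eval (quasiPoly s) (ℕ→ℚ (point k)) ∎
    where open ≡-Reasoning

-- This one value of c₀ excludes every period below 60.
c₀-1-unique : ∀ (i : Fin 59) → - c₀ (2 ℕ.+ toℕ i) ≢ - c₀ 1
c₀-1-unique = toWitness {a? = Fin.all? (λ i → ¬? (- c₀ (2 ℕ.+ toℕ i) ℚ.≟ - c₀ 1))} _

hasPeriod : HasPeriod (λ t → ℕ→ℚ (Sc t)) 60
hasPeriod = constituents , minimal
  where
  minimal : ∀ q .{{_ : NonZero q}} → Constituents (λ t → ℕ→ℚ (Sc t)) q → 60 ≤ q
  -- The arguments 1 and 1 + `suc q` share a constituent, hence its constant term. With `suc q`
  -- below 60 the second argument lies between 2 and 60, the range covered by `c₀-1-unique`.
  minimal (suc q) C = ℕ.≮⇒≥ λ q<60 → c₀-1-unique (fromℕ< (ℕ.≤-pred q<60)) (begin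
    - c₀ (2 ℕ.+ toℕ (fromℕ< (ℕ.≤-pred q<60)))   ≡⟨ cong (λ r → - c₀ (2 ℕ.+ r)) (Fin.toℕ-fromℕ< (ℕ.≤-pred q<60)) ⟩
    coeff (quasiPoly (2 ℕ.+ q)) 0               ≡⟨ constituent-unique C (2 ℕ.+ q) (ℕ.s≤s ℕ.z≤n) 0 ⟨
    coeff (Constituents.constituent C ((1 ℕ.+ suc q) mod suc q)) 0
      ≡⟨ cong (λ r → coeff (Constituents.constituent C r) 0)
           (mod-cong {1 ℕ.+ suc q} {1} (suc q) ([m+n]%n≡m%n 1 (suc q))) ⟩
    coeff (Constituents.constituent C (1 mod suc q)) 0  ≡⟨ constituent-unique C 1 ℕ.≤-refl 0 ⟩
    - c₀ 1                                      ∎)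
    where open ≡-Reasoning
  minimal zero C = contradiction refl (ℕ.≢-nonZero⁻¹ 0)

mainTheorem3 : (generatingSeries Sc ≈ ScNumerator ÷ ScDenominator)
    × (∀ (t : ℕ) → t ≥ 1 →
    (2 ∣ t → ℕ→ℚ (Sc t) ≡
    (+ 3 / 10) * ℕ→ℚ t ^ 5 - (+ 75 / 8) * ℕ→ℚ t ^ 4 + (+ 331 / 3) * ℕ→ℚ t ^ 3 - (+ 5989 / 10) * ℕ→ℚ t ^ 2 + c₁ t * ℕ→ℚ t - c₀ t)
    × (2 ∤ t → ℕ→ℚ (Sc t) ≡
    (+ 3 / 10) * ℕ→ℚ t ^ 5 - (+ 75 / 8) * ℕ→ℚ t ^ 4 + (+ 331 / 3) * ℕ→ℚ t ^ 3 - (+ 11933 / 20) * ℕ→ℚ t ^ 2 + c₁ t * ℕ→ℚ t - c₀ t))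
    × HasPeriod (λ t → ℕ→ℚ (Sc t)) 60
    × HasPrincipalConstituent (λ t → ℕ→ℚ (Sc t))
    (- (+ 1296 / 1) ∷ + 1464 / 1 ∷ - (+ 5989 / 10) ∷ + 331 / 3 ∷ - (+ 75 / 8) ∷ + 3 / 10 ∷ [])
mainTheorem3 =
  rationalForm ,
  (λ t t≥1 → (λ 2∣t → polynomialForm t (+ 5989 / 10) t≥1 (c₂-even t 2∣t)) ,
             (λ 2∤t → polynomialForm t (+ 11933 / 20) t≥1 (c₂-odd t 2∤t))) ,
  hasPeriod ,
  -- The residue class 0 is represented by 60, constituents being constrained at positive arguments
  -- only.
  record { period = 60 ; hasPeriod = hasPeriod ; principal = λ C → constituent-unique C 60 (ℕ.s≤s ℕ.z≤n) }
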